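{- Let $(W,S)$ be a Coxeter system with $S$ finite, and let $\theta:W\to W$ be a group automorphism with $\theta^2=\mathrm{id}$ and $\theta(S)=S$. Let $w\in\mathfrak{I}(\theta)$ and suppose $s\in D_R(w)$. Then the map $v\mapsto v\underline{s}$ is a special matching on the interval $[e,w]$ of $\mathrm{Br}(\mathfrak{I}(\theta))$.
   Context: $e$ is the identity of $W$, $\ell$ the length function, $D_R(w)=\{s\in S\mid \ell(ws)<\ell(w)\}$. $\mathfrak{I}(\theta)=\{w\in W\mid \theta(w)=w^{ -1}\}$, and $\mathrm{Br}(\mathfrak{I}(\theta))$ is the subposet of the Bruhat order on $W$ induced on $\mathfrak{I}(\theta)$. For $s\in S$, $\underline{s}$ is a formal symbol acting on the right on $W$ by $v\underline{s}=vs$ if $\theta(s)vs=v$, and $v\underline{s}=\theta(s)vs$ otherwise. A special matching on a poset $Q$ is an involution $M:Q\to Q$ such that for every $x\in Q$ either $x$ covers $M(x)$ or $M(x)$ covers $x$, and such that for all $x,y\in Q$ with $M(x)\neq y$, if $y$ covers $x$ then $M(x)<M(y)$. -}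

module Defs where

open import Level using (Level; _⊔_; suc)
open import Algebra.Bundles using (Group)
open import Algebra.Morphism.Structures using (module GroupMorphisms)
open import Data.Nat using (ℕ; zero; _<_; _≤_) renaming (suc to 1+)
open import Data.Fin using (Fin)
open import Data.List using (List; []; _∷_; length)
open import Data.Product using (Σ; ∃; ∃-syntax; _×_; _,_)
open import Data.Sum using (_⊎_)
open import Relation.Nullary using (¬_)
open import Relation.Binary.PropositionalEquality using (_≡_; _≢_)

module _ {c ℓ : Level} (G : Group c ℓ) where
  open Group G

  pow : Carrier → ℕ → Carrier
  pow x zero = ε
  pow x (1+ k) = x ∙ pow x k

  prod : {n : ℕ} → (Fin n → Carrier) → List (Fin n) → Carrier
  prod s [] = ε
  prod s (i ∷ is) = s i ∙ prod s is

-- Coxeter matrix on Fin n; the entry 0 encodes m(s,t) = ∞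
record IsCoxeterMatrix {n : ℕ} (m : Fin n → Fin n → ℕ) : Set where
  field
    diag : ∀ i → m i i ≡ 1
    symm : ∀ i j → m i j ≡ m j i
    offdiag : ∀ i j → i ≢ j → m i j ≡ 0 ⊎ 2 ≤ m i j

-- (W,S) is a Coxeter system with S = {s i | i : Fin n} and Coxeter matrix m:
-- S generates W, the Coxeter relations hold, and W has the universal
-- property of the group presented by these generators and relations
-- (for target groups at the same universe levels as W).
record IsCoxeterSystem {c ℓ : Level} (W : Group c ℓ) {n : ℕ}
         (m : Fin n → Fin n → ℕ) (s : Fin n → Group.Carrier W)
         : Set (suc (c ⊔ ℓ)) where
  open Group W
  field
    coxeterMatrix : IsCoxeterMatrix m
    relations : ∀ i j → m i j ≢ 0 → pow W (s i ∙ s j) (m i j) ≈ ε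
    generates : ∀ (w : Carrier) → ∃[ ws ] prod W s ws ≈ w
    universal : (H : Group c ℓ) (g : Fin n → Group.Carrier H) →
      (∀ i j → m i j ≢ 0 → Group._≈_ H (pow H (Group._∙_ H (g i) (g j)) (m i j)) (Group.ε H)) →
      Σ (Carrier → Group.Carrier H) λ f →
        GroupMorphisms.IsGroupHomomorphism (Group.rawGroup W) (Group.rawGroup H) f
        × (∀ i → Group._≈_ H (f (s i)) (g i))

module Coxeter {c ℓ : Level} (W : Group c ℓ) {n : ℕ}
         (s : Fin n → Group.Carrier W) (θ : Group.Carrier W → Group.Carrier W) where
  open Group W

  record IsInvolutiveDiagramAut : Set (c ⊔ ℓ) where
    field
      automorphism : GroupMorphisms.IsGroupIsomorphism (Group.rawGroup W) (Group.rawGroup W) θ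
      involutive : ∀ w → θ (θ w) ≈ w
      θS⊆S : ∀ i → ∃[ j ] θ (s i) ≈ s j
      S⊆θS : ∀ j → ∃[ i ] θ (s i) ≈ s j

  Len : Carrier → ℕ → Set (ℓ)
  Len w k = (∃[ ws ] (length ws ≡ k × prod W s ws ≈ w))
          × (∀ ws → prod W s ws ≈ w → k ≤ length ws)

  _ℓ<_ : Carrier → Carrier → Set ℓ
  u ℓ< v = ∃[ a ] ∃[ b ] (Len u a × Len v b × a < b)

  RightDescent : Carrier → Fin n → Set ℓ
  RightDescent w i = (w ∙ s i) ℓ< w

  IsReflection : Carrier → Set (c ⊔ ℓ)
  IsReflection t = ∃[ x ] ∃[ i ] t ≈ (x ∙ s i) ∙ x ⁻¹

  data _≤B_ : Carrier → Carrier → Set (c ⊔ ℓ) where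
    ≤B-refl : ∀ {u v} → u ≈ v → u ≤B v
    ≤B-step : ∀ {u v} t → IsReflection t → u ℓ< (u ∙ t) → (u ∙ t) ≤B v → u ≤B v

  TwistedInvolution : Carrier → Set ℓ
  TwistedInvolution w = θ w ≈ w ⁻¹

  InInterval : Carrier → Carrier → Set (c ⊔ ℓ)
  InInterval w v = TwistedInvolution v × ε ≤B v × v ≤B w

  TwistedAct : Carrier → Fin n → Carrier → Set ℓ
  TwistedAct v i u =
      ((θ (s i) ∙ v) ∙ s i ≈ v × u ≈ v ∙ s i)
    ⊎ (¬ ((θ (s i) ∙ v) ∙ s i ≈ v) × u ≈ (θ (s i) ∙ v) ∙ s i)

  module _ {q : Level} (Q : Carrier → Set q) where
    _<Q_ : Carrier → Carrier → Set (c ⊔ ℓ)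
    x <Q y = x ≤B y × ¬ (x ≈ y)

    Covers : Carrier → Carrier → Set (c ⊔ ℓ ⊔ q)
    Covers y x = Q x × Q y × x <Q y × (∀ z → Q z → x <Q z → ¬ (z <Q y))

    record IsSpecialMatching (M : Carrier → Carrier) : Set (c ⊔ ℓ ⊔ q) where
      field
        maps-into : ∀ x → Q x → Q (M x)
        involution : ∀ x → Q x → M (M x) ≈ x
        matching : ∀ x → Q x → Covers x (M x) ⊎ Covers (M x) x
        special : ∀ x y → Q x → Q y → ¬ (M x ≈ y) → Covers y x → M x <Q M y

{-# OPTIONS --safe #-}
module Submission where

-- A Coxeter group acts on parity functions of its reflections, which gives the strong exchange
-- property; it also acts by a reflection representation in which s_r s_t has order exactly m(r,t).
-- Peeling letters of {r,t} off a reduced word then decides its descents, so the word problem is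
-- solvable and lengths are computable. Bruhat lifting on both sides shows that v ↦ v s̲ stays
-- below w and is monotone in the required sense. For the covering property, an element z of length
-- strictly between ℓ(θ(s)xs) and ℓ(x) in [θ(s)xs, x] would be xs or θ(s)x by lifting, and neither
-- is a twisted involution unless θ(s)xs = x.

open import Defs
open import Level using (Level; Lift; lift; lower; _⊔_)
open import Algebra.Bundles using (Group)
open import Algebra.Morphism.Structures using (module GroupMorphisms)
import Algebra.Properties.Group as GroupProperties
open import Data.Bool using (Bool; true; false; not)
open import Data.Empty using (⊥; ⊥-elim)
open import Data.Fin using (Fin; _≟_)
open import Data.Integer using (ℤ; 0ℤ; 1ℤ; _+_; _-_; -_)
import Data.Integer.Properties as ℤ
open import Data.Integer.Tactic.RingSolver using (solve-∀)
open import Data.List using (List; []; _∷_; _++_; reverse; foldr; length; map)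
import Data.List.Properties as List
open import Data.List.Relation.Binary.Permutation.Propositional using (↭-sym)
open import Data.List.Relation.Binary.Permutation.Propositional.Properties using (↭-reverse; All-resp-↭)
open import Data.List.Relation.Unary.All using (All; []; _∷_)
import Data.List.Relation.Unary.All.Properties as All
open import Data.Nat as ℕ using (ℕ; zero; suc; _≤_; _<_; z≤n; s≤s; _≡ᵇ_; _%_)
import Data.Nat.DivMod as ℕ
import Data.Nat.Properties as ℕ
open import Data.Product using (∃-syntax; _×_; _,_; proj₁; proj₂)
open import Data.Sum using (_⊎_; inj₁; inj₂)
open import Function using (_∘_)
open import Relation.Binary using (IsEquivalence)
open import Relation.Binary.PropositionalEquality as ≡ using (_≡_; _≢_; _≗_; refl; cong; cong₂; subst)
import Relation.Binary.Reasoning.Setoid as SetoidReasoning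
open import Relation.Nullary using (¬_; Dec; yes; no)
open import Relation.Nullary.Decidable using (decidable-stable)

-- Path operators and Chebyshev polynomials

-- Nothing is decidable at the outset: equality in W is an arbitrary relation, and length is only
-- the relation `Len`. Bruhat lifting nevertheless has to split on t = s_i and on whether s_i is a
-- descent, so the word problem must be solved before the order can be studied. Exchange alone does
-- not solve it, since it does not tell when two alternating words of equal length agree; that
-- requires the exact order of s_r s_t. Classically the order is read off from the number 2cos(π/m)
-- in a real representation. Here that number is replaced by an operator on integer sequences, the
-- adjacency operator of paths with m - 1 vertices: it is annihilated by the Chebyshev polynomial
-- U_{m-1}(X/2), but not by U_k(X/2) for smaller k. The parity argument precedes decidability and is
-- therefore carried out up to double negation. This suffices, because it only serves to refute
-- something or to prove an inequality of natural numbers.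

Seq : Set
Seq = ℕ → ℤ

record Linear (X : Seq → Seq) : Set where
  field
    cong-≗ : ∀ {f g} → f ≗ g → X f ≗ X g
    0-homo : X (λ _ → 0ℤ) ≗ (λ _ → 0ℤ)
    +-homo : ∀ f g → X (λ j → f j + g j) ≗ (λ j → X f j + X g j)
    neg-homo : ∀ f → X (λ j → - f j) ≗ (λ j → - X f j)

  ∸-homo : ∀ f g → X (λ j → f j - g j) ≗ (λ j → X f j - X g j)
  ∸-homo f g j = ≡.trans (+-homo f (λ k → - g k) j) (cong (λ a → X f j + a) (neg-homo g j))

open Linear

-- Chebyshev polynomials of the second kind, U_{k-1}(X/2).
cheb : (Seq → Seq) → ℕ → Seq → Seq
cheb X 0 f = λ _ → 0ℤ
cheb X 1 f = f
cheb X (suc (suc k)) f = λ j → X (cheb X (suc k) f) j - cheb X k f j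

combine-linear : ∀ {X P Q} → Linear X → Linear P → Linear Q →
  Linear (λ f j → X (P f) j - Q f j)
combine-linear {X} {P} {Q} X-lin P-lin Q-lin = record
  { cong-≗ = λ e j → cong₂ _-_ (cong-≗ X-lin (cong-≗ P-lin e) j) (cong-≗ Q-lin e j)
  ; 0-homo = λ j → cong₂ _-_ (≡.trans (cong-≗ X-lin (0-homo P-lin) j) (0-homo X-lin j)) (0-homo Q-lin j)
  ; +-homo = λ f g j → ≡.trans
      (cong₂ _-_ (≡.trans (cong-≗ X-lin (+-homo P-lin f g) j) (+-homo X-lin (P f) (P g) j)) (+-homo Q-lin f g j))
      (interchange (X (P f) j) (X (P g) j) (Q f j) (Q g j))
  ; neg-homo = λ f j → ≡.trans
      (cong₂ _-_ (≡.trans (cong-≗ X-lin (neg-homo P-lin f) j) (neg-homo X-lin (P f) j)) (neg-homo Q-lin f j))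
      (neg-distrib (X (P f) j) (Q f j)) }
  where
  interchange : ∀ a b c d → (a + b) - (c + d) ≡ (a - c) + (b - d)
  interchange = solve-∀
  neg-distrib : ∀ a b → - a - (- b) ≡ - (a - b)
  neg-distrib = solve-∀

module _ {X : Seq → Seq} (X-lin : Linear X) where

  cheb-linear : ∀ k → Linear (cheb X k)
  cheb-linear 0 = record
    { cong-≗ = λ _ _ → refl
    ; 0-homo = λ _ → refl
    ; +-homo = λ _ _ _ → refl
    ; neg-homo = λ _ _ → refl }
  cheb-linear 1 = record
    { cong-≗ = λ e → e
    ; 0-homo = λ _ → refl
    ; +-homo = λ _ _ _ → refl
    ; neg-homo = λ _ _ → refl }
  cheb-linear (suc (suc k)) = combine-linear X-lin (cheb-linear (suc k)) (cheb-linear k)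

  cheb-comm : ∀ {Y} → Linear Y → (∀ f → Y (X f) ≗ X (Y f)) →
    ∀ k f → Y (cheb X k f) ≗ cheb X k (Y f)
  cheb-comm Y-lin comm 0 f = 0-homo Y-lin
  cheb-comm Y-lin comm 1 f j = refl
  cheb-comm Y-lin comm (suc (suc k)) f j = ≡.trans (∸-homo Y-lin _ _ j)
    (cong₂ _-_ (≡.trans (comm _ j) (cong-≗ X-lin (cheb-comm Y-lin comm (suc k) f) j))
               (cheb-comm Y-lin comm k f j))

  cheb-X-comm : ∀ k f → cheb X k (X f) ≗ X (cheb X k f)
  cheb-X-comm k f j = ≡.sym (cheb-comm X-lin (λ _ _ → refl) k f j)

  cheb-cheb-comm : ∀ k l f → cheb X k (cheb X l f) ≗ cheb X l (cheb X k f)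
  cheb-cheb-comm k l = cheb-comm (cheb-linear k) (cheb-X-comm k) l

  cheb-suc : ∀ k f j → cheb X (suc (suc k)) f j ≡ cheb X (suc k) (X f) j - cheb X k f j
  cheb-suc k f j = cong (λ u → u - cheb X k f j) (≡.sym (cheb-X-comm (suc k) f j))

  module _ (z : ℕ → Seq) (rec : ∀ t → z (suc (suc t)) ≗ (λ j → X (z (suc t)) j - z t j)) where

    -- The addition formula for solutions of the three-term recursion. Taken with b = a or b = a +
    -- 1, it sums every second term of a solution in closed form.
    cheb-add : ∀ a b j →
      cheb X (suc a) (z (suc b)) j ≡ cheb X a (z b) j + z (suc (a ℕ.+ b)) j
    cheb-add zero b j = ≡.sym (ℤ.+-identityˡ _)
    cheb-add (suc a) b j = begin
      X (cheb X (suc a) z₁) j - cheb X a z₁ j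
        ≡⟨ shuffle (X (cheb X (suc a) z₁) j) (cheb X a z₁ j) (cheb X (suc a) z₀ j) ⟩
      cheb X (suc a) z₀ j + ((X (cheb X (suc a) z₁) j - cheb X (suc a) z₀ j) - cheb X a z₁ j)
        ≡⟨ cong (λ u → cheb X (suc a) z₀ j + (u - cheb X a z₁ j)) (≡.sym eq) ⟩
      cheb X (suc a) z₀ j + (cheb X (suc a) (z (suc (suc b))) j - cheb X a z₁ j)
        ≡⟨ cong (λ u → cheb X (suc a) z₀ j + (u - cheb X a z₁ j)) (cheb-add a (suc b) j) ⟩
      cheb X (suc a) z₀ j + ((cheb X a z₁ j + z (suc (a ℕ.+ suc b)) j) - cheb X a z₁ j)
        ≡⟨ cong (cheb X (suc a) z₀ j +_) (cancel (cheb X a z₁ j) (z (suc (a ℕ.+ suc b)) j)) ⟩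
      cheb X (suc a) z₀ j + z (suc (a ℕ.+ suc b)) j
        ≡⟨ cong (λ t → cheb X (suc a) z₀ j + z (suc t) j) (ℕ.+-suc a b) ⟩
      cheb X (suc a) z₀ j + z (suc (suc (a ℕ.+ b))) j ∎
      where
      open ≡.≡-Reasoning
      z₀ = z b
      z₁ = z (suc b)
      shuffle : ∀ u v w → u - v ≡ w + ((u - w) - v)
      shuffle = solve-∀
      cancel : ∀ u v → (u + v) - u ≡ v
      cancel = solve-∀
      P = cheb-linear (suc a)
      eq : cheb X (suc a) (z (suc (suc b))) j ≡ X (cheb X (suc a) z₁) j - cheb X (suc a) z₀ j
      eq = ≡.trans (cong-≗ P (rec b) j)
             (≡.trans (∸-homo P (X z₁) z₀ j) (cong (λ u → u - cheb X (suc a) z₀ j) (cheb-X-comm (suc a) z₁ j)))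

gate : Bool → ℤ → ℤ
gate true a = a
gate false a = 0ℤ

-- Whether k and k + 1 are adjacent: ℕ is cut into paths with d − 1 vertices
-- (a single infinite path for d = 0; the value for d = 1 is irrelevant).
linked : ℕ → ℕ → Bool
linked 0 k = true
linked 1 k = true
linked (suc (suc e)) k = not ((suc k % suc e) ≡ᵇ 0)

-- On paths with d − 1 vertices the adjacency operator has characteristic polynomial cheb d.
path : ℕ → Seq → Seq
path d f zero = gate (linked d zero) (f 1)
path d f (suc j) = gate (linked d (suc j)) (f (suc (suc j))) + gate (linked d j) (f j)

gate-0 : ∀ b → gate b 0ℤ ≡ 0ℤ
gate-0 true = refl
gate-0 false = refl

gate-+ : ∀ b x y → gate b (x + y) ≡ gate b x + gate b y
gate-+ true x y = refl
gate-+ false x y = refl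

gate-neg : ∀ b x → gate b (- x) ≡ - gate b x
gate-neg true x = refl
gate-neg false x = refl

path-linear : ∀ d → Linear (path d)
path-linear d = record { cong-≗ = c ; 0-homo = z ; +-homo = a ; neg-homo = ng }
  where
  c : ∀ {f g} → f ≗ g → path d f ≗ path d g
  c e zero = cong (gate (linked d 0)) (e 1)
  c e (suc j) = cong₂ _+_ (cong (gate (linked d (suc j))) (e (suc (suc j)))) (cong (gate (linked d j)) (e j))
  z : path d (λ _ → 0ℤ) ≗ (λ _ → 0ℤ)
  z zero = gate-0 (linked d 0)
  z (suc j) = cong₂ _+_ (gate-0 (linked d (suc j))) (gate-0 (linked d j))
  a : ∀ f g → path d (λ j → f j + g j) ≗ (λ j → path d f j + path d g j)
  a f g zero = gate-+ (linked d 0) (f 1) (g 1)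
  a f g (suc j) = ≡.trans
    (cong₂ _+_ (gate-+ (linked d (suc j)) (f (suc (suc j))) (g (suc (suc j)))) (gate-+ (linked d j) (f j) (g j)))
    (swap (gate (linked d (suc j)) (f (suc (suc j)))) _ (gate (linked d j) (f j)) _)
    where
    swap : ∀ x y u v → (x + y) + (u + v) ≡ (x + u) + (y + v)
    swap = solve-∀
  ng : ∀ f → path d (λ j → - f j) ≗ (λ j → - path d f j)
  ng f zero = gate-neg (linked d 0) (f 1)
  ng f (suc j) = ≡.trans (cong₂ _+_ (gate-neg (linked d (suc j)) (f (suc (suc j)))) (gate-neg (linked d j) (f j)))
    (≡.sym (ℤ.neg-distrib-+ (gate (linked d (suc j)) (f (suc (suc j)))) (gate (linked d j) (f j))))

module _ (d : ℕ) (p : ℕ) (start : ∀ h → path d h p ≡ gate (linked d p) (h (suc p))) where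

  private X = path d

  -- By `start`, p is the left end of a path. From an end vertex the recursion subtracts exactly the
  -- walks that turn back, so each further polynomial reads off the entry one vertex to the right;
  -- the last edge may be cut, and then the value is 0.
  cheb-next : ∀ k → (∀ i → i < k → linked d (p ℕ.+ i) ≡ true) →
    ∀ h → cheb X (suc (suc k)) h p ≡ gate (linked d (p ℕ.+ k)) (h (suc (p ℕ.+ k)))
  cheb-at : ∀ k → (∀ i → i < k → linked d (p ℕ.+ i) ≡ true) →
    ∀ h → cheb X (suc k) h p ≡ h (p ℕ.+ k)

  cheb-next zero lk h rewrite ℕ.+-identityʳ p = ≡.trans (ℤ.+-identityʳ _) (start h)
  cheb-next (suc k) lk h = begin
    cheb X (3 ℕ.+ k) h p
      ≡⟨ cheb-suc (path-linear d) (suc k) h p ⟩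
    cheb X (2 ℕ.+ k) (X h) p - cheb X (suc k) h p
      ≡⟨ cong₂ _-_ (cheb-next k lk′ (X h)) (cheb-at k lk′ h) ⟩
    gate (linked d q) (X h (suc q)) - h q
      ≡⟨ cong (λ b → gate b (gate (linked d (suc q)) (h (suc (suc q))) + gate b (h q)) - h q) (lk k ℕ.≤-refl) ⟩
    (gate (linked d (suc q)) (h (suc (suc q))) + h q) - h q
      ≡⟨ cancel _ (h q) ⟩
    gate (linked d (suc q)) (h (suc (suc q)))
      ≡⟨ cong (λ r → gate (linked d r) (h (suc r))) (≡.sym (ℕ.+-suc p k)) ⟩
    gate (linked d (p ℕ.+ suc k)) (h (suc (p ℕ.+ suc k))) ∎
    where
    open ≡.≡-Reasoning
    q = p ℕ.+ k
    lk′ : ∀ i → i < k → linked d (p ℕ.+ i) ≡ true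
    lk′ i i<k = lk i (ℕ.m<n⇒m<1+n i<k)
    cancel : ∀ u v → (u + v) - v ≡ u
    cancel = solve-∀

  cheb-at zero lk h = cong h (≡.sym (ℕ.+-identityʳ p))
  cheb-at (suc k) lk h = ≡.trans (cheb-next k (λ i i<k → lk i (ℕ.m<n⇒m<1+n i<k)) h)
    (≡.trans (cong (λ b → gate b (h (suc (p ℕ.+ k)))) (lk k ℕ.≤-refl)) (cong h (≡.sym (ℕ.+-suc p k))))

module _ (e : ℕ) where

  private
    d = suc (suc e)
    N = suc e

  linked-inside : ∀ q i → i < e → linked d (q ℕ.* N ℕ.+ i) ≡ true
  linked-inside q i i<e = cong (λ x → not (x ≡ᵇ 0)) (begin
    suc (q ℕ.* N ℕ.+ i) % N ≡⟨ cong (λ x → suc x % N) (ℕ.+-comm (q ℕ.* N) i) ⟩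
    (suc i ℕ.+ q ℕ.* N) % N ≡⟨ ℕ.[m+kn]%n≡m%n (suc i) q N ⟩
    suc i % N               ≡⟨ ℕ.m<n⇒m%n≡m (s≤s i<e) ⟩
    suc i                   ∎)
    where open ≡.≡-Reasoning

  linked-end : ∀ q → linked d (q ℕ.* N ℕ.+ e) ≡ false
  linked-end q = cong (λ x → not (x ≡ᵇ 0)) (begin
    suc (q ℕ.* N ℕ.+ e) % N ≡⟨ cong (λ x → suc x % N) (ℕ.+-comm (q ℕ.* N) e) ⟩
    (N ℕ.+ q ℕ.* N) % N     ≡⟨ ℕ.[m+kn]%n≡m%n N q N ⟩
    N % N                   ≡⟨ ℕ.n%n≡0 N ⟩
    0                       ∎)
    where open ≡.≡-Reasoning

  block-start : ∀ q h → path d h (q ℕ.* N) ≡ gate (linked d (q ℕ.* N)) (h (suc (q ℕ.* N)))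
  block-start zero h = refl
  block-start (suc q) h = ≡.trans
    (cong (λ b → gate (linked d (suc q ℕ.* N)) (h (suc (suc q ℕ.* N))) + gate b (h (e ℕ.+ q ℕ.* N)))
      (≡.trans (cong (linked d) (ℕ.+-comm e (q ℕ.* N))) (linked-end q)))
    (ℤ.+-identityʳ _)

  -- At the left end of a path of d - 1 vertices, `cheb d` would have to read across the cut edge.
  -- Any other vertex lies r steps to the right of such an end, where its value is read by
  -- `cheb (suc r)`, and the two polynomials commute.
  cheb-path-vanishes : ∀ h → cheb (path d) d h ≗ (λ _ → 0ℤ)
  cheb-path-vanishes h j = begin
    cheb (path d) d h j
      ≡⟨ cong (cheb (path d) d h) (≡.trans (ℕ.m≡m%n+[m/n]*n j N) (ℕ.+-comm r (q ℕ.* N))) ⟩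
    cheb (path d) d h (q ℕ.* N ℕ.+ r)
      ≡⟨ ≡.sym (cheb-at d (q ℕ.* N) (block-start q) r
           (λ i i<r → linked-inside q i (ℕ.<-≤-trans i<r r≤e)) (cheb (path d) d h)) ⟩
    cheb (path d) (suc r) (cheb (path d) d h) (q ℕ.* N)
      ≡⟨ cheb-cheb-comm (path-linear d) (suc r) d h (q ℕ.* N) ⟩
    cheb (path d) d (cheb (path d) (suc r) h) (q ℕ.* N)
      ≡⟨ cheb-next d (q ℕ.* N) (block-start q) e (linked-inside q) _ ⟩
    gate (linked d (q ℕ.* N ℕ.+ e)) h′
      ≡⟨ cong (λ b → gate b h′) (linked-end q) ⟩
    0ℤ ∎
    where
    open ≡.≡-Reasoning
    r = j % N
    q = j ℕ./ N
    h′ = cheb (path d) (suc r) h (suc (q ℕ.* N ℕ.+ e))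
    r≤e : r ≤ e
    r≤e = ℕ.≤-pred (ℕ.m%n<n j N)

-- Stands in for sin((k+1)π/d) ≠ 0: it bounds the order of a product of two generators from below.
cheb-path-1 : ∀ d k → d ≡ 0 ⊎ suc k < d → cheb (path d) (suc k) (λ _ → 1ℤ) 0 ≡ 1ℤ
cheb-path-1 0 k _ = cheb-at 0 0 (λ _ → refl) k (λ _ _ → refl) _
cheb-path-1 1 k (inj₂ (s≤s ()))
cheb-path-1 (suc (suc e)) k (inj₂ (s≤s k≤e)) =
  cheb-at (suc (suc e)) 0 (λ _ → refl) k (λ i i<k → linked-inside e 0 i (ℕ.<-≤-trans i<k (ℕ.≤-pred k≤e))) _

-- Words and the presentation

power : {A : Set} → List A → ℕ → List A
power ws zero = []
power ws (suc k) = ws ++ power ws k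

alt : {A : Set} → A → A → ℕ → List A
alt r s zero = []
alt r s (suc k) = r ∷ alt s r k

letter : {A : Set} → A → A → ℕ → A
letter r s zero = r
letter r s (suc k) = letter s r k

module Presentation {n : ℕ} (m : Fin n → Fin n → ℕ) (m-diag : ∀ i → m i i ≡ 1) where

  Word : Set
  Word = List (Fin n)

  infix 4 _⇿_
  -- The relator carries an arbitrary suffix, so closure under prepending letters is enough for a
  -- congruence, and for actions by `foldr` only the relators have to be checked.
  data _⇿_ : Word → Word → Set where
    ⇿-refl : ∀ {u} → u ⇿ u
    ⇿-sym : ∀ {u v} → u ⇿ v → v ⇿ u
    ⇿-trans : ∀ {u v w} → u ⇿ v → v ⇿ w → u ⇿ w
    ⇿-cons : ∀ i {u v} → u ⇿ v → i ∷ u ⇿ i ∷ v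
    ⇿-rel : ∀ i j → m i j ≢ 0 → ∀ u → power (i ∷ j ∷ []) (m i j) ++ u ⇿ u

  ≡⇒⇿ : ∀ {u v} → u ≡ v → u ⇿ v
  ≡⇒⇿ refl = ⇿-refl

  ⇿-++ˡ : ∀ w {u v} → u ⇿ v → w ++ u ⇿ w ++ v
  ⇿-++ˡ [] e = e
  ⇿-++ˡ (i ∷ w) e = ⇿-cons i (⇿-++ˡ w e)

  ⇿-++ʳ : ∀ w {u v} → u ⇿ v → u ++ w ⇿ v ++ w
  ⇿-++ʳ w ⇿-refl = ⇿-refl
  ⇿-++ʳ w (⇿-sym e) = ⇿-sym (⇿-++ʳ w e)
  ⇿-++ʳ w (⇿-trans e f) = ⇿-trans (⇿-++ʳ w e) (⇿-++ʳ w f)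
  ⇿-++ʳ w (⇿-cons i e) = ⇿-cons i (⇿-++ʳ w e)
  ⇿-++ʳ w (⇿-rel i j ≢0 u) =
    ⇿-trans (≡⇒⇿ (List.++-assoc (power (i ∷ j ∷ []) (m i j)) u w)) (⇿-rel i j ≢0 (u ++ w))

  ⇿-square : ∀ i u → i ∷ i ∷ u ⇿ u
  ⇿-square i u = subst (λ k → power (i ∷ i ∷ []) k ++ u ⇿ u) (m-diag i)
    (⇿-rel i i (λ e → case (≡.trans (≡.sym (m-diag i)) e)) u)
    where
    case : 1 ≢ 0
    case ()

  ⇿-inverseˡ : ∀ u w → reverse u ++ (u ++ w) ⇿ w
  ⇿-inverseˡ [] w = ⇿-refl
  ⇿-inverseˡ (i ∷ u) w = ⇿-trans
    (≡⇒⇿ (≡.trans (cong (_++ (i ∷ u ++ w)) (List.unfold-reverse i u)) (List.++-assoc (reverse u) (i ∷ []) (i ∷ u ++ w))))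
    (⇿-trans (⇿-++ˡ (reverse u) (⇿-square i (u ++ w))) (⇿-inverseˡ u w))

  ⇿-inverseʳ : ∀ u w → u ++ (reverse u ++ w) ⇿ w
  ⇿-inverseʳ u w = subst (λ v → v ++ (reverse u ++ w) ⇿ w) (List.reverse-involutive u) (⇿-inverseˡ (reverse u) w)

  -- Reversal is inversion, as the generators are involutions, and inversion respects any group
  -- congruence; no induction on the derivation is needed.
  ⇿-reverse : ∀ {u v} → u ⇿ v → reverse u ⇿ reverse v
  ⇿-reverse {u} {v} e =
    ⇿-trans (≡⇒⇿ (≡.sym (List.++-identityʳ (reverse u))))
    (⇿-trans (⇿-++ˡ (reverse u) (⇿-sym (⇿-trans (⇿-++ˡ v (≡⇒⇿ (≡.sym (List.++-identityʳ (reverse v))))) (⇿-inverseʳ v []))))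
    (⇿-trans (⇿-++ˡ (reverse u) (⇿-++ʳ (reverse v) (⇿-sym e)))
    (⇿-inverseˡ u (reverse v))))

  -- Lifted because the universal property of W only concerns groups at its own levels.
  presented : ∀ c ℓ → Group c ℓ
  presented c ℓ = record
    { Carrier = Lift c Word
    ; _≈_ = λ u v → Lift ℓ (lower u ⇿ lower v)
    ; _∙_ = λ u v → lift (lower u ++ lower v)
    ; ε = lift []
    ; _⁻¹ = λ u → lift (reverse (lower u))
    ; isGroup = record
      { isMonoid = record
        { isSemigroup = record
          { isMagma = record
            { isEquivalence = record
              { refl = lift ⇿-refl
              ; sym = λ e → lift (⇿-sym (lower e))
              ; trans = λ e f → lift (⇿-trans (lower e) (lower f)) }
            ; ∙-cong = λ {u} {v} {x} {y} e f →
                lift (⇿-trans (⇿-++ʳ (lower x) (lower e)) (⇿-++ˡ (lower v) (lower f))) }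
          ; assoc = λ u v w → lift (≡⇒⇿ (List.++-assoc (lower u) (lower v) (lower w))) }
        ; identity = (λ u → lift ⇿-refl) , (λ u → lift (≡⇒⇿ (List.++-identityʳ (lower u)))) }
      ; inverse = (λ u → lift (⇿-trans (⇿-++ˡ (reverse (lower u)) (≡⇒⇿ (≡.sym (List.++-identityʳ (lower u))))) (⇿-inverseˡ (lower u) [])))
                , (λ u → lift (⇿-trans (⇿-++ˡ (lower u) (≡⇒⇿ (≡.sym (List.++-identityʳ (reverse (lower u)))))) (⇿-inverseʳ (lower u) [])))
      ; ⁻¹-cong = λ e → lift (⇿-reverse (lower e)) } }

  module _ {a b : Level} {X : Set a} {_∼_ : X → X → Set b} (∼-equiv : IsEquivalence _∼_)
    (act : Fin n → X → X) (act-cong : ∀ i {x y} → x ∼ y → act i x ∼ act i y)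
    (act-rel : ∀ i j → m i j ≢ 0 → ∀ x → foldr act x (power (i ∷ j ∷ []) (m i j)) ∼ x) where

    open IsEquivalence ∼-equiv using () renaming (refl to ∼-refl; sym to ∼-sym; trans to ∼-trans; reflexive to ∼-reflexive)

    ⇿-action : ∀ {u v} → u ⇿ v → ∀ x → foldr act x u ∼ foldr act x v
    ⇿-action ⇿-refl x = ∼-refl
    ⇿-action (⇿-sym e) x = ∼-sym (⇿-action e x)
    ⇿-action (⇿-trans e f) x = ∼-trans (⇿-action e x) (⇿-action f x)
    ⇿-action (⇿-cons i e) x = act-cong i (⇿-action e x)
    ⇿-action (⇿-rel i j ≢0 u) x = ∼-trans
      (∼-reflexive (List.foldr-++ act x (power (i ∷ j ∷ []) (m i j)) u))
      (act-rel i j ≢0 (foldr act x u))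

module CoxeterSystem {c ℓ : Level} (W : Group c ℓ) {n : ℕ} (m : Fin n → Fin n → ℕ)
  (s : Fin n → Group.Carrier W) (cox : IsCoxeterSystem W m s) where

  open Group W renaming (refl to ≈-refl; sym to ≈-sym; trans to ≈-trans; reflexive to ≈-reflexive)
  open IsCoxeterSystem cox
  open IsCoxeterMatrix coxeterMatrix
  open Presentation m diag public

  ⟦_⟧ : Word → Carrier
  ⟦_⟧ = prod W s

  infix 4 _≃_
  _≃_ : Word → Word → Set ℓ
  u ≃ v = ⟦ u ⟧ ≈ ⟦ v ⟧

  ⟦⟧-++ : ∀ u v → ⟦ u ++ v ⟧ ≈ ⟦ u ⟧ ∙ ⟦ v ⟧
  ⟦⟧-++ [] v = ≈-sym (identityˡ _)
  ⟦⟧-++ (i ∷ u) v = ≈-trans (∙-congˡ (⟦⟧-++ u v)) (≈-sym (assoc _ _ _))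

  -- The homomorphism supplied by the universal property sends s_i to the one-letter word i, hence
  -- recovers every word from its value. So whatever respects the relations is an invariant of group
  -- elements.
  ≃⇒⇿ : ∀ {u v} → u ≃ v → u ⇿ v
  ≃⇒⇿ {u} {v} e = ⇿-trans (⇿-sym (eval u)) (⇿-trans (lower (⟦⟧-cong e)) (eval v))
    where
    P = presented c ℓ
    pow-power : ∀ i j k → lower (pow P (lift (i ∷ j ∷ [])) k) ≡ power (i ∷ j ∷ []) k
    pow-power i j zero = refl
    pow-power i j (suc k) = cong (λ w → i ∷ j ∷ w) (pow-power i j k)
    hom = universal P (λ i → lift (i ∷ [])) (λ i j ≢0 → lift
      (⇿-trans (≡⇒⇿ (≡.trans (pow-power i j (m i j)) (≡.sym (List.++-identityʳ _)))) (⇿-rel i j ≢0 [])))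
    f = proj₁ hom
    open GroupMorphisms.IsGroupHomomorphism (proj₁ (proj₂ hom)) using (homo; ε-homo; ⟦⟧-cong)
    eval : ∀ w → lower (f ⟦ w ⟧) ⇿ w
    eval [] = lower ε-homo
    eval (i ∷ w) = ⇿-trans (lower (homo (s i) ⟦ w ⟧))
      (⇿-trans (⇿-++ʳ _ (lower (proj₂ (proj₂ hom) i))) (⇿-cons i (eval w)))

-- The reflection representation

module Representation {n : ℕ} (m : Fin n → Fin n → ℕ) (isMatrix : IsCoxeterMatrix m) where
  open IsCoxeterMatrix isMatrix
  open Presentation m diag

  Vector : Set
  Vector = Fin n → Seq

  infix 4 _≗₂_
  _≗₂_ : Vector → Vector → Set
  f ≗₂ g = ∀ k j → f k j ≡ g k j

  ≗₂-isEquivalence : IsEquivalence _≗₂_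
  ≗₂-isEquivalence = record
    { refl = λ _ _ → refl
    ; sym = λ e k j → ≡.sym (e k j)
    ; trans = λ e e′ k j → ≡.trans (e k j) (e′ k j) }

  -- Minus the Cartan matrix, with operators on sequences as entries.
  coef : Fin n → Fin n → Seq → Seq
  coef i k with i ≟ k
  ... | yes _ = λ f j → - (f j + f j)
  ... | no _ = path (m i k)

  coef-self : ∀ i f j → coef i i f j ≡ - (f j + f j)
  coef-self i f j with i ≟ i
  ... | yes _ = refl
  ... | no i≢i = ⊥-elim (i≢i refl)

  coef-other : ∀ {i k} → i ≢ k → ∀ f j → coef i k f j ≡ path (m i k) f j
  coef-other {i} {k} i≢k f j with i ≟ k
  ... | yes i≡k = ⊥-elim (i≢k i≡k)
  ... | no _ = refl

  coef-linear : ∀ i k → Linear (coef i k)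
  coef-linear i k with i ≟ k
  ... | no _ = path-linear (m i k)
  ... | yes _ = record
    { cong-≗ = λ e j → cong (λ x → - (x + x)) (e j)
    ; 0-homo = λ _ → refl
    ; +-homo = λ f g j → double-+ (f j) (g j)
    ; neg-homo = λ f j → double-neg (f j) }
    where
    double-+ : ∀ a b → - ((a + b) + (a + b)) ≡ - (a + a) + - (b + b)
    double-+ = solve-∀
    double-neg : ∀ a → - (- a + - a) ≡ - - (a + a)
    double-neg = solve-∀

  -- The contragredient of the reflection representation, f k being the value of the
  -- functional f on the simple root α_k: the Cartan entry −2cos(π/m) is replaced by
  -- −path m, which is all that the Coxeter relations need.
  act : Fin n → Vector → Vector
  act i f k j = f k j + coef i k (f i) j

  act-cong : ∀ i {f g} → f ≗₂ g → act i f ≗₂ act i g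
  act-cong i e k j = cong₂ _+_ (e k j) (cong-≗ (coef-linear i k) (e i) j)

  act-self : ∀ i f j → act i f i j ≡ - f i j
  act-self i f j = ≡.trans (cong (f i j +_) (coef-self i (f i) j)) (lemma (f i j))
    where
    lemma : ∀ a → a + - (a + a) ≡ - a
    lemma = solve-∀

  act-other : ∀ {i k} → i ≢ k → ∀ f j → act i f k j ≡ f k j + path (m i k) (f i) j
  act-other i≢k f j = cong (f _ j +_) (coef-other i≢k (f _) j)

  act-square : ∀ i f → act i (act i f) ≗₂ f
  act-square i f k j = begin
    (f k j + coef i k (f i) j) + coef i k (act i f i) j
      ≡⟨ cong (f k j + coef i k (f i) j +_) (≡.trans (cong-≗ (coef-linear i k) (act-self i f) j) (neg-homo (coef-linear i k) (f i) j)) ⟩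
    (f k j + coef i k (f i) j) + - coef i k (f i) j
      ≡⟨ lemma (f k j) (coef i k (f i) j) ⟩
    f k j ∎
    where
    open ≡.≡-Reasoning
    lemma : ∀ a b → (a + b) + - b ≡ a
    lemma = solve-∀

  module _ {i k : Fin n} (i≢k : i ≢ k) (f : Vector) where

    private
      d = m i k
      X = path d

    -- A single sequence carrying both coordinates in the plane of i and k: each reflection advances
    -- it by one term of the recursion. The sign of the initial term makes the recursion correct
    -- from the first reflection on.
    orbit : ℕ → Seq
    orbit zero j = - f i j
    orbit (suc zero) = f k
    orbit (suc (suc t)) j = X (orbit (suc t)) j - orbit t j

    orbit-rec : ∀ t j → orbit (suc (suc t)) j ≡ X (orbit (suc t)) j - orbit t j
    orbit-rec t j = refl

    -- The sums of orbit (2q + 1), resp. orbit (2q + 2), over q < p.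
    evens odds : ℕ → Seq
    evens p = cheb X p (orbit p)
    odds p = cheb X p (orbit (suc p))

    evens-suc : ∀ p → evens (suc p) ≗ (λ j → evens p j + orbit (suc (p ℕ.+ p)) j)
    evens-suc p = cheb-add (path-linear d) orbit orbit-rec p p

    odds-suc : ∀ p → odds (suc p) ≗ (λ j → odds p j + orbit (suc (p ℕ.+ suc p)) j)
    odds-suc p = cheb-add (path-linear d) orbit orbit-rec p (suc p)

    rotate : ℕ → Vector
    rotate p = foldr act f (power (i ∷ k ∷ []) p)

    -- The two coordinates in the plane are not enough for the Coxeter relation, as the rotation
    -- also changes f at every other root. That change is a Cartan entry applied to the sum of all
    -- values met so far, which `evens` and `odds` give in closed form.
    record Rotated (p : ℕ) : Set where
      field
        at-k : ∀ j → rotate p k j ≡ orbit (suc (p ℕ.+ p)) j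
        at-i : ∀ j → rotate p i j ≡ - orbit (p ℕ.+ p) j
        everywhere : ∀ l j → rotate p l j ≡ (f l j + coef k l (evens p) j) + coef i l (odds p) j
    open Rotated

    rotated : ∀ p → Rotated p
    rotated zero = record
      { at-k = λ j → refl
      ; at-i = λ j → ≡.sym (ℤ.neg-involutive (f i j))
      ; everywhere = λ l j → ≡.sym (≡.trans
          (cong₂ _+_ (cong (f l j +_) (0-homo (coef-linear k l) j)) (0-homo (coef-linear i l) j))
          (lemma (f l j))) }
      where
      lemma : ∀ a → (a + 0ℤ) + 0ℤ ≡ a
      lemma = solve-∀
    rotated (suc p) = record
      { at-k = λ j → begin
          act i g k j                                    ≡⟨ act-other i≢k g j ⟩
          g k j + X (g i) j                              ≡⟨ cong₂ _+_ (≡.trans (act-self k (rotate p) j) (cong -_ (at-k r j))) (cong-≗ (path-linear d) g-i j) ⟩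
          - orbit (suc q) j + X (orbit (suc (suc q))) j  ≡⟨ ℤ.+-comm (- orbit (suc q) j) _ ⟩
          orbit (suc (suc (suc q))) j                    ≡⟨ cong (λ t → orbit (suc (suc t)) j) (≡.sym (ℕ.+-suc p p)) ⟩
          orbit (suc (suc (p ℕ.+ suc p))) j              ∎
      ; at-i = λ j → ≡.trans (act-self i g j) (cong -_ (≡.trans (g-i j) (cong (λ t → orbit (suc t) j) (≡.sym (ℕ.+-suc p p)))))
      ; everywhere = λ l j → begin
          (rotate p l j + coef k l (rotate p k) j) + coef i l (g i) j
            ≡⟨ cong₂ _+_ (cong₂ _+_ (everywhere r l j) (cong-≗ (coef-linear k l) (at-k r) j))
                 (cong-≗ (coef-linear i l) (λ j′ → ≡.trans (g-i j′) (cong (λ t → orbit (suc t) j′) (≡.sym (ℕ.+-suc p p)))) j) ⟩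
          (((f l j + coef k l (evens p) j) + coef i l (odds p) j) + coef k l (orbit (suc q)) j) + coef i l (orbit (suc (p ℕ.+ suc p))) j
            ≡⟨ lemma (f l j) (coef k l (evens p) j) (coef i l (odds p) j) (coef k l (orbit (suc q)) j) (coef i l (orbit (suc (p ℕ.+ suc p))) j) ⟩
          (f l j + (coef k l (evens p) j + coef k l (orbit (suc q)) j)) + (coef i l (odds p) j + coef i l (orbit (suc (p ℕ.+ suc p))) j)
            ≡⟨ cong₂ _+_ (cong (f l j +_) (≡.sym (≡.trans (cong-≗ (coef-linear k l) (evens-suc p) j) (+-homo (coef-linear k l) (evens p) (orbit (suc q)) j))))
                 (≡.sym (≡.trans (cong-≗ (coef-linear i l) (odds-suc p) j) (+-homo (coef-linear i l) (odds p) (orbit (suc (p ℕ.+ suc p))) j))) ⟩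
          (f l j + coef k l (evens (suc p)) j) + coef i l (odds (suc p)) j ∎ }
      where
      open ≡.≡-Reasoning
      r = rotated p
      q = p ℕ.+ p
      g = act k (rotate p)
      g-i : g i ≗ orbit (suc (suc q))
      g-i j = begin
        act k (rotate p) i j
          ≡⟨ act-other (λ e → i≢k (≡.sym e)) (rotate p) j ⟩
        rotate p i j + path (m k i) (rotate p k) j
          ≡⟨ cong₂ _+_ (at-i r j) (≡.trans (cong (λ e → path e (rotate p k) j) (symm k i)) (cong-≗ (path-linear d) (at-k r) j)) ⟩
        - orbit q j + X (orbit (suc q)) j
          ≡⟨ ℤ.+-comm (- orbit q j) _ ⟩
        orbit (suc (suc q)) j ∎
      lemma : ∀ a b c e h → (((a + b) + c) + e) + h ≡ (a + (b + e)) + (c + h)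
      lemma = solve-∀

    -- For p = d both accumulated sums are values of `cheb X d`, so the change disappears at every
    -- root at once.
    rotate-trivial : (∀ h → cheb X d h ≗ (λ _ → 0ℤ)) → rotate d ≗₂ f
    rotate-trivial vanishes l j = ≡.trans (Rotated.everywhere (rotated d) l j) (≡.trans
      (cong₂ _+_ (cong (f l j +_) (zero-at k (vanishes _))) (zero-at i (vanishes _))) (lemma (f l j)))
      where
      zero-at : ∀ i′ {h} → h ≗ (λ _ → 0ℤ) → coef i′ l h j ≡ 0ℤ
      zero-at i′ h≗0 = ≡.trans (cong-≗ (coef-linear i′ l) h≗0 j) (0-homo (coef-linear i′ l) j)
      lemma : ∀ a → (a + 0ℤ) + 0ℤ ≡ a
      lemma = solve-∀

  act-rel : ∀ i k → m i k ≢ 0 → ∀ f → foldr act f (power (i ∷ k ∷ []) (m i k)) ≗₂ f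
  act-rel i k ≢0 f with i ≟ k
  ... | yes refl rewrite diag i = act-square i f
  ... | no i≢k with offdiag i k i≢k
  ...   | inj₁ ≡0 = ⊥-elim (≢0 ≡0)
  ...   | inj₂ 2≤m = rotate-trivial i≢k f (vanishes 2≤m)
    where
    vanishes : ∀ {d} → 2 ≤ d → ∀ h → cheb (path d) d h ≗ (λ _ → 0ℤ)
    vanishes (s≤s (s≤s _)) = cheb-path-vanishes _

  act-invariant : ∀ {u v} → u ⇿ v → ∀ f → foldr act f u ≗₂ foldr act f v
  act-invariant = ⇿-action ≗₂-isEquivalence act act-cong act-rel

  act-reverse : ∀ i u f → foldr act f (reverse (i ∷ u)) ≡ foldr act (act i f) (reverse u)
  act-reverse i u f = ≡.trans (cong (foldr act f) (List.unfold-reverse i u)) (List.foldr-++ act f (reverse u) (i ∷ []))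

  -- `foldr` lets the last letter act first. After reversal the head of `alt` acts first, so the
  -- induction can absorb it into f: one reflection turns the pair of Chebyshev values into the pair
  -- for k + 1, with r and t exchanged.
  act-alternating : ∀ {r t} → r ≢ t → ∀ h q k f →
    (∀ j → f r j ≡ cheb (path (m r t)) (suc k) h j) →
    (∀ j → f t j ≡ - cheb (path (m r t)) k h j) →
    let g = foldr act f (reverse (alt r t q)) in
    (∀ j → g (letter r t q) j ≡ cheb (path (m r t)) (suc (k ℕ.+ q)) h j) ×
    (∀ j → g (letter t r q) j ≡ - cheb (path (m r t)) (k ℕ.+ q) h j)
  act-alternating r≢t h zero k f e e′ rewrite ℕ.+-identityʳ k = e , e′
  act-alternating {r} {t} r≢t h (suc q) k f e e′
    rewrite act-reverse r (alt t r q) f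
          | ℕ.+-suc k q
          | symm r t
    = act-alternating (λ e → r≢t (≡.sym e)) h q (suc k) (act r f) at-t at-r
    where
    at-t : ∀ j → act r f t j ≡ cheb (path (m t r)) (suc (suc k)) h j
    at-t j = ≡.trans (act-other r≢t f j) (≡.trans
      (cong₂ _+_ (e′ j) (≡.trans (cong (λ d → path d (f r) j) (symm r t)) (cong-≗ (path-linear (m t r)) e j)))
      (ℤ.+-comm (- cheb (path (m t r)) k h j) _))
    at-r : ∀ j → act r f r j ≡ - cheb (path (m t r)) (suc k) h j
    at-r j = ≡.trans (act-self r f j) (cong -_ (e j))

  -- The test functional is 1 on α_r and 0 on α_t, hence fixed by s_t, so the second word acts like
  -- one with a letter less. On the root of `letter r t q` the two words then give the same
  -- Chebyshev value with opposite signs, and at vertex 0 this value is 1.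
  alternating-distinct : ∀ {r t} → r ≢ t → ∀ q → m r t ≡ 0 ⊎ suc q < m r t →
    ¬ reverse (alt r t (suc q)) ⇿ reverse (alt t r (suc q))
  alternating-distinct {r} {t} r≢t q small e = 1≢-1 (≡.trans (≡.sym (at (proj₂ lhs) )) (≡.trans (act-invariant e f t′ 0) (at′ (proj₁ rhs))))
    where
    P = cheb (path (m r t))
    one : Seq
    one _ = 1ℤ
    f : Vector
    f k j with k ≟ r
    ... | yes _ = 1ℤ
    ... | no _ = 0ℤ
    f-r : ∀ j → f r j ≡ 1ℤ
    f-r j with r ≟ r
    ... | yes _ = refl
    ... | no r≢r = ⊥-elim (r≢r refl)
    f-t : ∀ j → f t j ≡ 0ℤ
    f-t j with t ≟ r
    ... | yes t≡r = ⊥-elim (r≢t (≡.sym t≡r))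
    ... | no _ = refl
    t′ = letter r t q
    lhs = act-alternating r≢t one (suc q) 0 f f-r f-t
    fixed : act t f ≗₂ f
    fixed k j = ≡.trans (cong (f k j +_) (≡.trans (cong-≗ (coef-linear t k) f-t j) (0-homo (coef-linear t k) j))) (ℤ.+-identityʳ _)
    rhs = act-alternating r≢t one q 0 (act t f) (λ j → ≡.trans (fixed r j) (f-r j)) (λ j → ≡.trans (fixed t j) (f-t j))
    at : (∀ j → foldr act f (reverse (alt r t (suc q))) t′ j ≡ - P (suc q) one j) →
      foldr act f (reverse (alt r t (suc q))) t′ 0 ≡ - 1ℤ
    at eq = ≡.trans (eq 0) (cong -_ (cheb-path-1 (m r t) q small))
    at′ : (∀ j → foldr act (act t f) (reverse (alt r t q)) t′ j ≡ P (suc q) one j) →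
      foldr act f (reverse (alt t r (suc q))) t′ 0 ≡ 1ℤ
    at′ eq = ≡.trans (cong (λ g → g t′ 0) (act-reverse t (alt r t q) f))
      (≡.trans (eq 0) (cheb-path-1 (m r t) q small))
    1≢-1 : - 1ℤ ≢ 1ℤ
    1≢-1 ()

-- Parity of reflections and strong exchange

infix 4 _≋_
-- Equivalence up to double negation. Both directions conclude in a negation, so `≋-by-cases` may
-- use excluded middle for any proposition.
_≋_ : ∀ {a b} → Set a → Set b → Set (a ⊔ b)
A ≋ B = (¬ A → ¬ B) × (¬ B → ¬ A)

≋-refl : ∀ {a} {A : Set a} → A ≋ A
≋-refl = (λ f → f) , (λ f → f)

≋-sym : ∀ {a b} {A : Set a} {B : Set b} → A ≋ B → B ≋ A
≋-sym (f , g) = g , f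

≋-trans : ∀ {a b c} {A : Set a} {B : Set b} {C : Set c} → A ≋ B → B ≋ C → A ≋ C
≋-trans (f , g) (h , k) = (λ x → h (f x)) , (λ x → g (k x))

⇔⇒≋ : ∀ {a b} {A : Set a} {B : Set b} → (A → B) → (B → A) → A ≋ B
⇔⇒≋ f g = (λ ¬a b → ¬a (g b)) , (λ ¬b a → ¬b (f a))

¬-cong : ∀ {a b} {A : Set a} {B : Set b} → A ≋ B → (¬ A) ≋ (¬ B)
¬-cong (f , g) = (λ nna nb → nna (g nb)) , (λ nnb na → nnb (f na))

¬¬-≋ : ∀ {a} {A : Set a} → (¬ ¬ A) ≋ A
¬¬-≋ = (λ nnna a → nnna (λ na → na a)) , (λ na nna → nna na)

≋-by-cases : ∀ {a b c} (P : Set c) {A : Set a} {B : Set b} → (P → A ≋ B) → (¬ P → A ≋ B) → A ≋ B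
≋-by-cases P f g =
    (λ ¬a b → (λ ¬p → proj₁ (g ¬p) ¬a b) (λ p → proj₁ (f p) ¬a b))
  , (λ ¬b a → (λ ¬p → proj₂ (g ¬p) ¬b a) (λ p → proj₂ (f p) ¬b a))

module _ {a : Level} where

  xor : Set a → Set a → Set a
  xor P Q = (P × ¬ Q) ⊎ (¬ P × Q)

  xor-yes : ∀ {P Q} → P → xor P Q ≋ (¬ Q)
  xor-yes p = ⇔⇒≋ (λ { (inj₁ (_ , ¬q)) → ¬q ; (inj₂ (¬p , _)) → ⊥-elim (¬p p) }) (λ ¬q → inj₁ (p , ¬q))

  xor-no : ∀ {P Q} → ¬ P → xor P Q ≋ Q
  xor-no ¬p = ⇔⇒≋ (λ { (inj₁ (p , _)) → ⊥-elim (¬p p) ; (inj₂ (_ , q)) → q }) (λ q → inj₂ (¬p , q))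

  xor-congʳ : ∀ P {Q Q′} → Q ≋ Q′ → xor P Q ≋ xor P Q′
  xor-congʳ P e = ≋-by-cases P
    (λ p → ≋-trans (xor-yes p) (≋-trans (¬-cong e) (≋-sym (xor-yes p))))
    (λ ¬p → ≋-trans (xor-no ¬p) (≋-trans e (≋-sym (xor-no ¬p))))

  xor-congˡ : ∀ {P P′} Q → (P → P′) → (P′ → P) → xor P Q ≋ xor P′ Q
  xor-congˡ Q f g = ⇔⇒≋
    (λ { (inj₁ (p , ¬q)) → inj₁ (f p , ¬q) ; (inj₂ (¬p , q)) → inj₂ (¬p ∘ g , q) })
    (λ { (inj₁ (p , ¬q)) → inj₁ (g p , ¬q) ; (inj₂ (¬p , q)) → inj₂ (¬p ∘ f , q) })

  xor-cancel : ∀ P Q → xor P (xor P Q) ≋ Q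
  xor-cancel P Q = ≋-by-cases P
    (λ p → ≋-trans (xor-yes p) (≋-trans (¬-cong (xor-yes p)) ¬¬-≋))
    (λ ¬p → ≋-trans (xor-no ¬p) (xor-no ¬p))

  xor-cancel-¬ : ∀ P Q → xor P (¬ xor P Q) ≋ (¬ Q)
  xor-cancel-¬ P Q = ≋-by-cases P
    (λ p → ≋-trans (xor-yes p) (≋-trans ¬¬-≋ (xor-yes p)))
    (λ ¬p → ≋-trans (xor-no ¬p) (¬-cong (xor-no ¬p)))

  xor-left-comm : ∀ P Q R → xor P (xor Q R) ≋ xor Q (xor P R)
  xor-left-comm P Q R = ≋-by-cases P
    (λ p → ≋-trans (xor-yes p) (≋-trans
      (≋-by-cases Q
        (λ q → ≋-trans (¬-cong (xor-yes q)) (≋-sym (xor-yes q)))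
        (λ ¬q → ≋-trans (¬-cong (xor-no ¬q)) (≋-sym (xor-no ¬q))))
      (xor-congʳ Q (≋-sym (xor-yes p)))))
    (λ ¬p → ≋-trans (xor-no ¬p) (xor-congʳ Q (≋-sym (xor-no ¬p))))

data Del {A : Set} : List A → List A → Set where
  here : ∀ {x xs} → Del (x ∷ xs) xs
  there : ∀ {x xs ys} → Del xs ys → Del (x ∷ xs) (x ∷ ys)

Del-length : ∀ {A : Set} {xs ys : List A} → Del xs ys → suc (length ys) ≡ length xs
Del-length here = refl
Del-length (there d) = cong suc (Del-length d)

Del-++ : ∀ {A : Set} (xs : List A) {ys zs} → Del (xs ++ ys) zs →
  (∃[ xs′ ] (Del xs xs′ × zs ≡ xs′ ++ ys)) ⊎ (∃[ ys′ ] (Del ys ys′ × zs ≡ xs ++ ys′))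
Del-++ [] d = inj₂ (_ , d , refl)
Del-++ (x ∷ xs) here = inj₁ (xs , here , refl)
Del-++ (x ∷ xs) (there d) with Del-++ xs d
... | inj₁ (xs′ , d′ , refl) = inj₁ (x ∷ xs′ , there d′ , refl)
... | inj₂ (ys′ , d′ , refl) = inj₂ (ys′ , d′ , refl)

module Parity {c ℓ : Level} (W : Group c ℓ) {n : ℕ} (m : Fin n → Fin n → ℕ)
  (s : Fin n → Group.Carrier W) (cox : IsCoxeterSystem W m s) where

  open CoxeterSystem W m s cox public
  open Group W renaming (refl to ≈-refl; sym to ≈-sym; trans to ≈-trans; reflexive to ≈-reflexive)
  open IsCoxeterSystem cox
  open IsCoxeterMatrix coxeterMatrix
  open SetoidReasoning setoid
  open GroupProperties W

  s² : ∀ i → s i ∙ s i ≈ ε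
  s² i = ≈-trans (≈-sym (identityʳ _))
    (subst (λ k → pow W (s i ∙ s i) k ≈ ε) (diag i) (relations i i (λ e → 1≢0 (≡.trans (≡.sym (diag i)) e))))
    where
    1≢0 : 1 ≢ 0
    1≢0 ()

  s-cancelˡ : ∀ i x → s i ∙ (s i ∙ x) ≈ x
  s-cancelˡ i x = ≈-trans (≈-sym (assoc _ _ _)) (≈-trans (∙-congʳ (s² i)) (identityˡ x))

  s-cancelʳ : ∀ i x → (x ∙ s i) ∙ s i ≈ x
  s-cancelʳ i x = ≈-trans (assoc _ _ _) (≈-trans (∙-congˡ (s² i)) (identityʳ x))

  conj : Fin n → Carrier → Carrier
  conj i t = s i ∙ (t ∙ s i)

  conj-cong : ∀ i {t u} → t ≈ u → conj i t ≈ conj i u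
  conj-cong i e = ∙-congˡ (∙-congʳ e)

  conj-s : ∀ i → conj i (s i) ≈ s i
  conj-s i = s-cancelˡ i (s i)

  conj-swap : ∀ i t → s i ∙ conj i t ≈ t ∙ s i
  conj-swap i t = s-cancelˡ i _

  conj-involutive : ∀ i t → conj i (conj i t) ≈ t
  conj-involutive i t = begin
    s i ∙ ((s i ∙ (t ∙ s i)) ∙ s i) ≈⟨ ∙-congˡ (assoc _ _ _) ⟩
    s i ∙ (s i ∙ ((t ∙ s i) ∙ s i)) ≈⟨ s-cancelˡ i _ ⟩
    (t ∙ s i) ∙ s i                 ≈⟨ s-cancelʳ i t ⟩
    t                               ∎

  conj-adjoint : ∀ i {t u} → conj i t ≈ u → t ≈ conj i u
  conj-adjoint i {t} e = ≈-trans (≈-sym (conj-involutive i t)) (conj-cong i e)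

  record Predicate : Set (c ⊔ Level.suc ℓ) where
    field
      holds : Carrier → Set ℓ
      resp : ∀ {t u} → t ≈ u → holds t → holds u
  open Predicate

  infix 4 _∼_
  _∼_ : Predicate → Predicate → Set (c ⊔ ℓ)
  f ∼ g = ∀ t → holds f t ≋ holds g t

  ∼-isEquivalence : IsEquivalence _∼_
  ∼-isEquivalence = record
    { refl = λ _ → ≋-refl
    ; sym = λ e t → ≋-sym (e t)
    ; trans = λ e f t → ≋-trans (e t) (f t) }

  -- The action behind the cocycle N(s_i w) = {s_i} △ s_i N(w) s_i, where N(w) is the set of left
  -- inversions of w.
  toggle : Fin n → Predicate → Predicate
  toggle i f = record
    { holds = λ t → xor (t ≈ s i) (holds f (conj i t))
    ; resp = λ e → λ
        { (inj₁ (p , ¬q)) → inj₁ (≈-trans (≈-sym e) p , λ q → ¬q (resp f (conj-cong i (≈-sym e)) q))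
        ; (inj₂ (¬p , q)) → inj₂ ((λ p → ¬p (≈-trans e p)) , resp f (conj-cong i e) q) } }

  toggle-cong : ∀ i {f g} → f ∼ g → toggle i f ∼ toggle i g
  toggle-cong i e t = xor-congʳ (t ≈ s i) (e (conj i t))

  module _ (i j : Fin n) where

    private
      r = s i ∙ s j
      rotate : ℕ → Carrier
      rotate = pow W r

    rotate-+ : ∀ a b → rotate (a ℕ.+ b) ≈ rotate a ∙ rotate b
    rotate-+ zero b = ≈-sym (identityˡ _)
    rotate-+ (suc a) b = ≈-trans (∙-congˡ (rotate-+ a b)) (≈-sym (assoc _ _ _))

    -- The 2k reflections r^a s_i, ..., r^(a+2k-1) s_i read off from the word (ij)^k.
    toggles : ℕ → ℕ → Set ℓ → Carrier → Set ℓ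
    toggles a zero B t = B
    toggles a (suc k) B t = xor (t ≈ rotate a ∙ s i) (toggles (suc a) k B t)

    toggles-cong : ∀ a k {B B′} t → B ≋ B′ → toggles a k B t ≋ toggles a k B′ t
    toggles-cong a zero t e = e
    toggles-cong a (suc k) t e = xor-congʳ _ (toggles-cong (suc a) k t e)

    toggles-+ : ∀ a k l B t → toggles a (k ℕ.+ l) B t ≡ toggles a k (toggles (k ℕ.+ a) l B t) t
    toggles-+ a zero l B t = refl
    toggles-+ a (suc k) l B t = cong (xor _)
      (≡.trans (toggles-+ (suc a) k l B t) (cong (λ b → toggles (suc a) k (toggles b l B t) t) (ℕ.+-suc k a)))

    toggles-comm : ∀ P a k B t → xor P (toggles a k B t) ≋ toggles a k (xor P B) t
    toggles-comm P a zero B t = ≋-refl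
    toggles-comm P a (suc k) B t = ≋-trans (xor-left-comm P _ _) (xor-congʳ _ (toggles-comm P (suc a) k B t))

    toggles-cancel : ∀ a k B t → toggles a k (toggles a k B t) t ≋ B
    toggles-cancel a zero B t = ≋-refl
    toggles-cancel a (suc k) B t = ≋-trans
      (xor-congʳ _ (≋-sym (toggles-comm _ (suc a) k _ t)))
      (≋-trans (xor-cancel _ _) (toggles-cancel (suc a) k B t))

    toggles-period : ∀ {p} → rotate p ≈ ε → ∀ a k B t → toggles (p ℕ.+ a) k B t ≋ toggles a k B t
    toggles-period {p} e a zero B t = ≋-refl
    toggles-period {p} e a (suc k) B t = ≋-trans
      (xor-congˡ _ (λ q → ≈-trans q (∙-congʳ same)) (λ q → ≈-trans q (∙-congʳ (≈-sym same))))
      (xor-congʳ _ (subst (λ b → toggles b k B t ≋ toggles (suc a) k B t) (ℕ.+-suc p a) (toggles-period {p} e (suc a) k B t)))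
      where
      same : rotate (p ℕ.+ a) ≈ rotate a
      same = ≈-trans (rotate-+ p a) (≈-trans (∙-congʳ e) (identityˡ _))

    -- Conjugation t ↦ r⁻¹tr. It is handled through `r-double-conj`, which mentions no inverse.
    double-conj : Carrier → Carrier
    double-conj t = conj j (conj i t)

    r-double-conj : ∀ t → r ∙ double-conj t ≈ t ∙ r
    r-double-conj t = begin
      (s i ∙ s j) ∙ conj j (conj i t) ≈⟨ assoc _ _ _ ⟩
      s i ∙ (s j ∙ conj j (conj i t)) ≈⟨ ∙-congˡ (conj-swap j _) ⟩
      s i ∙ (conj i t ∙ s j)          ≈⟨ ≈-sym (assoc _ _ _) ⟩
      (s i ∙ conj i t) ∙ s j          ≈⟨ ∙-congʳ (conj-swap i t) ⟩
      (t ∙ s i) ∙ s j                 ≈⟨ assoc _ _ _ ⟩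
      t ∙ (s i ∙ s j)                 ∎

    double-conj-cong : ∀ {t u} → t ≈ u → double-conj t ≈ double-conj u
    double-conj-cong e = conj-cong j (conj-cong i e)

    double-conj-injective : ∀ {t u} → double-conj t ≈ double-conj u → t ≈ u
    double-conj-injective {t} {u} e = ∙-cancelʳ r t u
      (≈-trans (≈-sym (r-double-conj t)) (≈-trans (∙-congˡ e) (r-double-conj u)))

    -- As s_i inverts r, conjugating r^(a+2) s_i by r lowers the exponent by two.
    double-conj-root : ∀ a → double-conj (rotate (suc (suc a)) ∙ s i) ≈ rotate a ∙ s i
    double-conj-root a = ∙-cancelˡ r _ _ (begin
      r ∙ double-conj (rotate (suc (suc a)) ∙ s i) ≈⟨ r-double-conj _ ⟩
      ((r ∙ (r ∙ rotate a)) ∙ s i) ∙ r             ≈⟨ ∙-congʳ (assoc _ _ _) ⟩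
      (r ∙ ((r ∙ rotate a) ∙ s i)) ∙ r             ≈⟨ assoc _ _ _ ⟩
      r ∙ (((r ∙ rotate a) ∙ s i) ∙ (s i ∙ s j))   ≈⟨ ∙-congˡ (≈-sym (assoc _ _ _)) ⟩
      r ∙ ((((r ∙ rotate a) ∙ s i) ∙ s i) ∙ s j)   ≈⟨ ∙-congˡ (∙-congʳ (s-cancelʳ i _)) ⟩
      r ∙ ((r ∙ rotate a) ∙ s j)                   ≈⟨ ∙-congˡ (∙-congʳ (rotate-comm a)) ⟩
      r ∙ ((rotate a ∙ r) ∙ s j)                   ≈⟨ ∙-congˡ (assoc _ _ _) ⟩
      r ∙ (rotate a ∙ (r ∙ s j))                   ≈⟨ ∙-congˡ (∙-congˡ (s-cancelʳ j (s i))) ⟩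
      r ∙ (rotate a ∙ s i)                         ∎)
      where
      rotate-comm : ∀ a → r ∙ rotate a ≈ rotate a ∙ r
      rotate-comm zero = ≈-trans (identityʳ r) (≈-sym (identityˡ r))
      rotate-comm (suc a) = ≈-trans (∙-congˡ (rotate-comm a)) (≈-sym (assoc _ _ _))

    toggles-shift : ∀ a k B t → toggles a k B (double-conj t) ≋ toggles (suc (suc a)) k B t
    toggles-shift a zero B t = ≋-refl
    toggles-shift a (suc k) B t = ≋-trans
      (xor-congˡ _
        (λ e → double-conj-injective (≈-trans e (≈-sym (double-conj-root a))))
        (λ e → ≈-trans (double-conj-cong e) (double-conj-root a)))
      (xor-congʳ _ (toggles-shift (suc a) k B t))

    iterate : ℕ → Carrier → Carrier
    iterate zero t = t
    iterate (suc k) t = iterate k (double-conj t)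

    rotate-iterate : ∀ k t → rotate k ∙ iterate k t ≈ t ∙ rotate k
    rotate-iterate zero t = ≈-trans (identityˡ t) (≈-sym (identityʳ t))
    rotate-iterate (suc k) t = begin
      (r ∙ rotate k) ∙ iterate k (double-conj t) ≈⟨ assoc _ _ _ ⟩
      r ∙ (rotate k ∙ iterate k (double-conj t)) ≈⟨ ∙-congˡ (rotate-iterate k _) ⟩
      r ∙ (double-conj t ∙ rotate k)             ≈⟨ ≈-sym (assoc _ _ _) ⟩
      (r ∙ double-conj t) ∙ rotate k             ≈⟨ ∙-congʳ (r-double-conj t) ⟩
      (t ∙ r) ∙ rotate k                         ≈⟨ assoc _ _ _ ⟩
      t ∙ (r ∙ rotate k)                         ∎

    toggle-power : ∀ k f t →
      holds (foldr toggle f (power (i ∷ j ∷ []) k)) t ≋ toggles 0 (k ℕ.+ k) (holds f (iterate k t)) t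
    toggle-power zero f t = ≋-refl
    toggle-power (suc k) f t = subst
      (λ l → holds (foldr toggle f (power (i ∷ j ∷ []) (suc k))) t ≋ toggles 0 (suc l) B t)
      (≡.sym (ℕ.+-suc k k))
      (≋-trans
        (xor-congˡ _ (λ e → ≈-trans e (≈-sym (identityˡ _))) (λ e → ≈-trans e (identityˡ _)))
        (xor-congʳ _ (≋-trans
          (xor-congˡ _
            (λ e → ≈-trans (conj-adjoint i e) second)
            (λ e → ≈-sym (conj-adjoint i (≈-sym (≈-trans e (≈-sym second))))))
          (xor-congʳ _ (≋-trans (toggle-power k f (double-conj t)) (toggles-shift 0 (k ℕ.+ k) B t))))))
      where
      B = holds f (iterate (suc k) t)
      second : conj i (s j) ≈ rotate 1 ∙ s i
      second = ≈-trans (≈-sym (assoc _ _ _)) (∙-congʳ (≈-sym (identityʳ _)))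

    -- With p = m(i,j), the relator toggles 2p reflections. Since r^p = e, the second half repeats
    -- the first, so every toggle is undone.
    toggle-rel : m i j ≢ 0 → ∀ f → foldr toggle f (power (i ∷ j ∷ []) (m i j)) ∼ f
    toggle-rel ≢0 f t = ≋-trans (toggle-power p f t)
      (≋-trans (subst (_≋ toggles 0 p (toggles 0 p B t) t) (≡.sym (toggles-+ 0 p p B t))
          (toggles-cong 0 p t (toggles-period {p} rel 0 p B t)))
      (≋-trans (toggles-cancel 0 p B t)
        (⇔⇒≋ (resp f fixed) (resp f (≈-sym fixed)))))
      where
      p = m i j
      B = holds f (iterate p t)
      rel = relations i j ≢0
      fixed : iterate p t ≈ t
      fixed = begin
        iterate p t            ≈⟨ ≈-sym (identityˡ _) ⟩
        ε ∙ iterate p t        ≈⟨ ∙-congʳ (≈-sym rel) ⟩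
        rotate p ∙ iterate p t ≈⟨ rotate-iterate p t ⟩
        t ∙ rotate p           ≈⟨ ∙-congˡ rel ⟩
        t ∙ ε                  ≈⟨ identityʳ t ⟩
        t                      ∎

  nowhere : Predicate
  nowhere = record { holds = λ _ → Lift ℓ ⊥ ; resp = λ _ x → x }

  -- η u t: the reflection t occurs an odd number of times among s₁⋯s_{j-1} s_j s_{j-1}⋯s₁ for
  -- u = s₁⋯s_k. Equality in W is not yet known to be decidable, so the parity is a proposition,
  -- meaningful up to double negation.
  η : Word → Carrier → Set ℓ
  η u = holds (foldr toggle nowhere u)

  η-cong : ∀ {u v} → u ≃ v → ∀ t → η u t ≋ η v t
  η-cong {u} {v} e = ⇿-action ∼-isEquivalence toggle toggle-cong toggle-rel {u} {v} (≃⇒⇿ e) nowhere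

  η-resp : ∀ u {t t′} → t ≈ t′ → η u t → η u t′
  η-resp u = resp (foldr toggle nowhere u)

  -- Odd parity forces t to occur at least once, as s₁⋯s_{j-1} s_j s_{j-1}⋯s₁; multiplying u by it
  -- from the left removes the letter s_j.
  η-deletes : ∀ u t → η u t → ¬ ¬ (∃[ v ] (Del u v × ⟦ v ⟧ ≈ t ∙ ⟦ u ⟧))
  η-deletes (i ∷ u) t (inj₁ (t≈s , _)) k = k (u , here , ≈-sym (≈-trans (∙-congʳ t≈s) (s-cancelˡ i _)))
  η-deletes (i ∷ u) t (inj₂ (_ , o)) k = η-deletes u (conj i t) o λ { (v , d , e) → k (i ∷ v , there d , (begin
    s i ∙ ⟦ v ⟧                  ≈⟨ ∙-congˡ e ⟩
    s i ∙ (conj i t ∙ ⟦ u ⟧)     ≈⟨ ≈-sym (assoc _ _ _) ⟩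
    (s i ∙ conj i t) ∙ ⟦ u ⟧     ≈⟨ ∙-congʳ (conj-swap i t) ⟩
    (t ∙ s i) ∙ ⟦ u ⟧            ≈⟨ assoc _ _ _ ⟩
    t ∙ (s i ∙ ⟦ u ⟧)            ∎)) }

  reflection : Word → Fin n → Carrier
  reflection [] i = s i
  reflection (a ∷ x) i = conj a (reflection x i)

  -- The word x i x⁻¹ u, with u as an accumulator that collects x⁻¹.
  reflect : Word → Fin n → Word → Word
  reflect [] i u = i ∷ u
  reflect (a ∷ x) i u = a ∷ reflect x i (a ∷ u)

  reflect-≈ : ∀ x i u → ⟦ reflect x i u ⟧ ≈ reflection x i ∙ ⟦ u ⟧
  reflect-≈ [] i u = ≈-refl
  reflect-≈ (a ∷ x) i u = begin
    s a ∙ ⟦ reflect x i (a ∷ u) ⟧       ≈⟨ ∙-congˡ (reflect-≈ x i (a ∷ u)) ⟩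
    s a ∙ (t ∙ (s a ∙ ⟦ u ⟧))           ≈⟨ ∙-congˡ (≈-sym (assoc _ _ _)) ⟩
    s a ∙ ((t ∙ s a) ∙ ⟦ u ⟧)           ≈⟨ ≈-sym (assoc _ _ _) ⟩
    conj a t ∙ ⟦ u ⟧                    ∎
    where t = reflection x i

  reflection² : ∀ x i → reflection x i ∙ reflection x i ≈ ε
  reflection² [] i = s² i
  reflection² (a ∷ x) i = begin
    (s a ∙ (t ∙ s a)) ∙ (s a ∙ (t ∙ s a)) ≈⟨ assoc _ _ _ ⟩
    s a ∙ ((t ∙ s a) ∙ (s a ∙ (t ∙ s a))) ≈⟨ ∙-congˡ (assoc _ _ _) ⟩
    s a ∙ (t ∙ (s a ∙ (s a ∙ (t ∙ s a)))) ≈⟨ ∙-congˡ (∙-congˡ (s-cancelˡ a _)) ⟩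
    s a ∙ (t ∙ (t ∙ s a))                 ≈⟨ ∙-congˡ (≈-sym (assoc _ _ _)) ⟩
    s a ∙ ((t ∙ t) ∙ s a)                 ≈⟨ ∙-congˡ (≈-trans (∙-congʳ (reflection² x i)) (identityˡ _)) ⟩
    s a ∙ s a                             ≈⟨ s² a ⟩
    ε                                     ∎
    where t = reflection x i

  -- Along the palindrome x i x⁻¹ the two copies of each letter of x toggle t together and cancel;
  -- only the middle letter remains.
  η-reflect : ∀ x i u → η (reflect x i u) (reflection x i) ≋ (¬ η u (reflection x i))
  η-reflect [] i u = ≋-trans (xor-yes ≈-refl)
    (¬-cong (⇔⇒≋ (η-resp u (conj-s i)) (η-resp u (≈-sym (conj-s i)))))
  η-reflect (a ∷ x) i u = ≋-trans
    (xor-congˡ _ (λ e → ≈-trans (conj-adjoint a e) (conj-s a)) (λ e → ≈-trans (conj-cong a e) (conj-s a)))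
    (≋-trans (xor-congʳ _ (≋-trans
        (⇔⇒≋ (η-resp v (conj-involutive a t)) (η-resp v (≈-sym (conj-involutive a t))))
        (η-reflect x i (a ∷ u))))
      (xor-cancel-¬ (t ≈ s a) (η u (conj a t))))
    where
    t = reflection x i
    v = reflect x i (a ∷ u)

  Reduced : Word → Set ℓ
  Reduced u = ∀ v → v ≃ u → length u ≤ length v

  -- If t had even parity in u, it would have odd parity in v = tu, and a deletion in v would give a
  -- word for u shorter than the reduced one. So t is odd in u, and u itself admits the deletion.
  strong-exchange : ∀ {u v} x i → Reduced u → ⟦ v ⟧ ≈ reflection x i ∙ ⟦ u ⟧ → length v ≤ length u →
    ¬ ¬ (∃[ w ] (Del u w × ⟦ w ⟧ ≈ reflection x i ∙ ⟦ u ⟧))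
  strong-exchange {u} {v} x i red e v≤u k =
    proj₁ (η-reflect x i u) (proj₁ (η-cong {v} {reflect x i u} e′ t) v-even) u-even
    where
    t = reflection x i
    e′ : v ≃ reflect x i u
    e′ = ≈-trans e (≈-sym (reflect-≈ x i u))
    u-even : ¬ η u t
    u-even odd = η-deletes u t odd k
    v-even : ¬ η v t
    v-even odd = η-deletes v t odd λ { (w , d , w≈) → ℕ.<⇒≱
      (ℕ.<-≤-trans (ℕ.≤-reflexive (Del-length d)) v≤u)
      (red w (begin
        ⟦ w ⟧           ≈⟨ w≈ ⟩
        t ∙ ⟦ v ⟧       ≈⟨ ∙-congˡ e ⟩
        t ∙ (t ∙ ⟦ u ⟧) ≈⟨ ≈-sym (assoc _ _ _) ⟩
        (t ∙ t) ∙ ⟦ u ⟧ ≈⟨ ≈-trans (∙-congʳ (reflection² x i)) (identityˡ _) ⟩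
        ⟦ u ⟧           ∎)) }

-- Descents and the word problem

length-alt : {A : Set} (r t : A) (l : ℕ) → length (alt r t l) ≡ l
length-alt r t zero = refl
length-alt r t (suc l) = cong suc (length-alt t r l)

alt-snoc : {A : Set} (r t : A) (l : ℕ) → alt r t (suc l) ≡ alt r t l ++ letter r t l ∷ []
alt-snoc r t zero = refl
alt-snoc r t (suc l) = cong (r ∷_) (alt-snoc t r l)

alt-All : ∀ {A : Set} {p} {P : A → Set p} {r t : A} → P r → P t → ∀ l → All P (alt r t l)
alt-All pr pt zero = []
alt-All pr pt (suc l) = pr ∷ alt-All pt pr l

letters : ∀ {A : Set} {p} {P : A → Set p} {r t : A} l → P (letter r t l) → P (letter t r l) → P r × P t
letters zero p q = p , q
letters {P = P} (suc l) p q = let pt , pr = letters {P = P} l p q in pr , pt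

alt-Del : {A : Set} {r t : A} (l : ℕ) {z : List A} → Del (alt r t l) z →
  ∃[ q ] ∃[ b ] (q < l × z ≡ alt r t q ++ b × alt r t l ≡ alt r t (suc q) ++ b)
alt-Del (suc l) here = 0 , _ , s≤s z≤n , refl , refl
alt-Del {r = r} (suc l) (there d) =
  let q , b , q<l , z≡ , alt≡ = alt-Del l d in
  suc q , b , s≤s q<l , cong (r ∷_) z≡ , cong (r ∷_) alt≡

All-Del : ∀ {A : Set} {p} {P : A → Set p} {xs ys : List A} → Del xs ys → All P xs → All P ys
All-Del here (_ ∷ ps) = ps
All-Del (there d) (p ∷ ps) = p ∷ All-Del d ps

module Descents {c ℓ : Level} (W : Group c ℓ) {n : ℕ} (m : Fin n → Fin n → ℕ)
  (s : Fin n → Group.Carrier W) (cox : IsCoxeterSystem W m s) where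

  open Parity W m s cox public
  open Group W renaming (refl to ≈-refl; sym to ≈-sym; trans to ≈-trans; reflexive to ≈-reflexive)
  open IsCoxeterSystem cox
  open IsCoxeterMatrix coxeterMatrix
  open SetoidReasoning setoid
  open GroupProperties W
  open Representation m coxeterMatrix using (alternating-distinct)

  ≃-++ˡ : ∀ w {u v} → u ≃ v → w ++ u ≃ w ++ v
  ≃-++ˡ w {u} {v} e = ≈-trans (⟦⟧-++ w u) (≈-trans (∙-congˡ e) (≈-sym (⟦⟧-++ w v)))

  ≃-++ʳ : ∀ w {u v} → u ≃ v → u ++ w ≃ v ++ w
  ≃-++ʳ w {u} {v} e = ≈-trans (⟦⟧-++ u w) (≈-trans (∙-congʳ e) (≈-sym (⟦⟧-++ v w)))

  ≃-cancelʳ : ∀ w {u v} → u ++ w ≃ v ++ w → u ≃ v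
  ≃-cancelʳ w {u} {v} e = ∙-cancelʳ ⟦ w ⟧ _ _ (≈-trans (≈-sym (⟦⟧-++ u w)) (≈-trans e (⟦⟧-++ v w)))

  ≡⇒≃ : ∀ {u v} → u ≡ v → u ≃ v
  ≡⇒≃ refl = ≈-refl

  ≃-square : ∀ i u → i ∷ i ∷ u ≃ u
  ≃-square i u = s-cancelˡ i ⟦ u ⟧

  ≃-flip : ∀ {i u v} → i ∷ u ≃ v → u ≃ i ∷ v
  ≃-flip {i} {u} e = ≈-trans (≈-sym (≃-square i u)) (∙-congˡ e)

  ⟦reverse⟧-inverse : ∀ u → ⟦ reverse u ⟧ ∙ ⟦ u ⟧ ≈ ε
  ⟦reverse⟧-inverse [] = identityˡ ε
  ⟦reverse⟧-inverse (i ∷ u) = begin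
    ⟦ reverse (i ∷ u) ⟧ ∙ (s i ∙ ⟦ u ⟧)           ≈⟨ ∙-congʳ (≈-trans (≡⇒≃ (List.unfold-reverse i u)) (⟦⟧-++ (reverse u) (i ∷ []))) ⟩
    (⟦ reverse u ⟧ ∙ (s i ∙ ε)) ∙ (s i ∙ ⟦ u ⟧)   ≈⟨ ∙-congʳ (∙-congˡ (identityʳ _)) ⟩
    (⟦ reverse u ⟧ ∙ s i) ∙ (s i ∙ ⟦ u ⟧)         ≈⟨ assoc _ _ _ ⟩
    ⟦ reverse u ⟧ ∙ (s i ∙ (s i ∙ ⟦ u ⟧))         ≈⟨ ∙-congˡ (s-cancelˡ i _) ⟩
    ⟦ reverse u ⟧ ∙ ⟦ u ⟧                         ≈⟨ ⟦reverse⟧-inverse u ⟩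
    ε                                             ∎

  ⟦reverse⟧ : ∀ u → ⟦ reverse u ⟧ ≈ ⟦ u ⟧ ⁻¹
  ⟦reverse⟧ u = inverseˡ-unique _ _ (⟦reverse⟧-inverse u)

  alternating-relation : ∀ r t → m r t ≢ 0 → alt r t (m r t) ≃ alt t r (m r t)
  alternating-relation r t ≢0 = ≈-trans (rotate (m r t)) (≈-trans (∙-congʳ (relations r t ≢0)) (identityˡ _))
    where
    x = s r ∙ s t
    comm : ∀ k → pow W x k ∙ x ≈ x ∙ pow W x k
    comm zero = ≈-trans (identityˡ x) (≈-sym (identityʳ x))
    comm (suc k) = ≈-trans (assoc _ _ _) (∙-congˡ (comm k))
    rotate : ∀ k → ⟦ alt r t k ⟧ ≈ pow W x k ∙ ⟦ alt t r k ⟧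
    rotate 0 = ≈-sym (identityˡ ε)
    rotate 1 = begin
      s r ∙ ε                        ≈⟨ ∙-congʳ (≈-sym (s-cancelʳ t (s r))) ⟩
      (x ∙ s t) ∙ ε                  ≈⟨ assoc _ _ _ ⟩
      x ∙ (s t ∙ ε)                  ≈⟨ ∙-congʳ (≈-sym (identityʳ x)) ⟩
      (x ∙ ε) ∙ (s t ∙ ε)            ∎
    rotate (suc (suc k)) = begin
      s r ∙ (s t ∙ ⟦ alt r t k ⟧)                      ≈⟨ ≈-sym (assoc _ _ _) ⟩
      x ∙ ⟦ alt r t k ⟧                                ≈⟨ ∙-congˡ (rotate k) ⟩
      x ∙ (p ∙ v)                                      ≈⟨ ∙-congˡ (∙-congˡ (≈-sym v≈)) ⟩
      x ∙ (p ∙ (x ∙ (s t ∙ (s r ∙ v))))                ≈⟨ ∙-congˡ (≈-sym (assoc _ _ _)) ⟩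
      x ∙ ((p ∙ x) ∙ (s t ∙ (s r ∙ v)))                ≈⟨ ∙-congˡ (∙-congʳ (comm k)) ⟩
      x ∙ ((x ∙ p) ∙ (s t ∙ (s r ∙ v)))                ≈⟨ ≈-sym (assoc _ _ _) ⟩
      (x ∙ (x ∙ p)) ∙ (s t ∙ (s r ∙ v))                ∎
      where
      p = pow W x k
      v = ⟦ alt t r k ⟧
      v≈ : x ∙ (s t ∙ (s r ∙ v)) ≈ v
      v≈ = ≈-trans (assoc _ _ _) (≈-trans (∙-congˡ (s-cancelˡ t _)) (s-cancelˡ r v))

  alternating-≄ : ∀ {r t} → r ≢ t → ∀ q → m r t ≡ 0 ⊎ suc q < m r t →
    ¬ alt r t (suc q) ≃ alt t r (suc q)
  alternating-≄ {r} {t} r≢t q small e =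
    alternating-distinct r≢t q small (⇿-reverse (≃⇒⇿ {alt r t (suc q)} {alt t r (suc q)} e))

  Reduced-resp : ∀ {u v} → u ≃ v → length u ≡ length v → Reduced u → Reduced v
  Reduced-resp e l red w w≃v = subst (_≤ length w) l (red w (≈-trans w≃v (≈-sym e)))

  Reduced-++⁻ʳ : ∀ u {v} → Reduced (u ++ v) → Reduced v
  Reduced-++⁻ʳ u {v} red w w≃v = ℕ.+-cancelˡ-≤ (length u) (length v) (length w)
    (≡.subst₂ _≤_ (List.length-++ u) (List.length-++ u) (red (u ++ w) (≃-++ˡ u {w} {v} w≃v)))

  -- ¬ η w (s a) says that a is not a left descent of w: for z in a standard parabolic
  -- subgroup, w is the minimal representative of its coset.
  minimal-coset : ∀ w → Reduced w → ∀ k z v → length z ≤ k →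
    All (λ a → ¬ η w (s a)) z → z ++ v ≃ w → length w ≤ length v
  minimal-coset w red k [] v _ _ e = red v e
  minimal-coset w red (suc k) (a ∷ z) v (s≤s z≤k) (pa ∷ pz) e =
    decidable-stable (length w ℕ.≤? length v) λ ¬le →
      proj₁ (η-reflect [] a (z ++ v)) (proj₁ (η-cong {w} {a ∷ z ++ v} (≈-sym e) (s a)) pa) λ odd →
      η-deletes (z ++ v) (s a) odd λ { (y , d , y≈) → ¬le (shorter (≈-trans y≈ e) (Del-++ z d)) }
    where
    shorter : ∀ {y} → y ≃ w → (∃[ z′ ] (Del z z′ × y ≡ z′ ++ v)) ⊎ (∃[ v′ ] (Del v v′ × y ≡ z ++ v′)) →
      length w ≤ length v
    shorter y≃w (inj₁ (z′ , d , refl)) =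
      minimal-coset w red k z′ v (ℕ.≤-trans (ℕ.n≤1+n _) (ℕ.≤-trans (ℕ.≤-reflexive (Del-length d)) z≤k)) (All-Del d pz) y≃w
    shorter y≃w (inj₂ (v′ , d , refl)) =
      ℕ.≤-trans (minimal-coset w red k z v′ z≤k pz y≃w) (ℕ.≤-trans (ℕ.n≤1+n _) (ℕ.≤-reflexive (Del-length d)))

  Descends : Fin n → Word → Set ℓ
  Descends i u = ∃[ v ] (i ∷ v ≃ u × suc (length v) ≡ length u)

  ascent-even : ∀ i u → Reduced (i ∷ u) → ¬ η u (s i)
  ascent-even i u red odd = η-deletes u (s i) odd λ { (v , d , v≈) →
    ℕ.<⇒≱ (ℕ.≤-trans (ℕ.≤-reflexive (Del-length d)) (ℕ.n≤1+n _)) (red v v≈) }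

  module _ {r t : Fin n} (r≢t : r ≢ t) (l : ℕ) {w : Word} where

    private
      a = alt r t (suc l)
      u = a ++ w

    -- Otherwise exchange deletes a letter of a w and yields t a w. If the letter lies in a,
    -- cancelling on the right equates two alternating words of equal length below m(r,t). If it
    -- lies in w, then w is the product of an element generated by r, t and a shorter word; but
    -- neither r nor t is a left descent of w, one because a w is reduced and the other by `red′`,
    -- so w is minimal in its coset.
    ascends : Reduced u → Reduced (letter r t (suc l) ∷ w) → m r t ≡ 0 ⊎ suc l < m r t → Reduced (t ∷ u)
    ascends red red′ small v v≃ = ℕ.≰⇒> λ v≤u → strong-exchange {u} {v} [] t red v≃ v≤u
        λ { (y , d , y≈) → absurd y≈ (Del-++ a d) }
      where
      shorter : ∀ {y} → Del w y → alt r t l ++ y ≃ u → ⊥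
      shorter {y} d e = ℕ.<⇒≱
        (s≤s (cast (ℕ.+-monoʳ-≤ (length (alt r t l)) (ℕ.≤-trans (ℕ.n≤1+n _) (ℕ.≤-reflexive (Del-length d))))))
        (red (alt r t l ++ y) e)
        where
        cast : length (alt r t l) ℕ.+ length y ≤ length (alt r t l) ℕ.+ length w →
          length (alt r t l ++ y) ≤ length (alt t r l ++ w)
        cast rewrite List.length-++ (alt r t l) {y} | List.length-++ (alt t r l) {w}
                      | length-alt r t l | length-alt t r l = λ x → x
      last-even : ¬ η w (s (letter r t l))
      last-even odd = η-deletes w _ odd λ { (y , d , y≈) → shorter d (≈-trans
        (≃-++ˡ (alt r t l) {y} {letter r t l ∷ w} y≈)
        (≡⇒≃ (≡.sym (≡.trans (cong (_++ w) (alt-snoc r t l)) (List.++-assoc (alt r t l) (letter r t l ∷ []) w))))) }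
      both-even : (¬ η w (s r)) × (¬ η w (s t))
      both-even = letters {P = λ x → ¬ η w (s x)} l last-even (ascent-even (letter t r l) w red′)
      absurd : ∀ {y} → y ≃ t ∷ u →
        (∃[ a′ ] (Del a a′ × y ≡ a′ ++ w)) ⊎ (∃[ w′ ] (Del w w′ × y ≡ a ++ w′)) → ⊥
      absurd y≃ (inj₁ (a′ , d , refl)) with alt-Del (suc l) d
      ... | q , b , q≤l , refl , a≡ = alternating-≄ r≢t q (small′ small)
              (≃-cancelʳ b {alt r t (suc q)} {alt t r (suc q)}
                (≃-cancelʳ w {alt r t (suc q) ++ b} {alt t r (suc q) ++ b}
                  (≈-trans (≡⇒≃ (cong (_++ w) (≡.sym a≡))) (≃-flip {t} {u} {(alt r t q ++ b) ++ w} (≈-sym y≃)))))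
        where
        small′ : m r t ≡ 0 ⊎ suc l < m r t → m r t ≡ 0 ⊎ suc q < m r t
        small′ (inj₁ e) = inj₁ e
        small′ (inj₂ lt) = inj₂ (ℕ.≤-<-trans q≤l lt)
      absurd y≃ (inj₂ (w′ , d , refl)) = ℕ.<⇒≱ (ℕ.≤-reflexive (Del-length d))
        (minimal-coset w (Reduced-++⁻ʳ a {w} red) (length z) z w′ ℕ.≤-refl z-even z≃)
        where
        z = reverse a ++ t ∷ a
        z-even = All.++⁺ (All-resp-↭ (↭-sym (↭-reverse a)) (alt-All (proj₁ both-even) (proj₂ both-even) (suc l)))
                   (proj₂ both-even ∷ alt-All (proj₁ both-even) (proj₂ both-even) (suc l))
        z≃ : z ++ w′ ≃ w
        z≃ = begin
          ⟦ (reverse a ++ t ∷ a) ++ w′ ⟧  ≈⟨ ≡⇒≃ (List.++-assoc (reverse a) (t ∷ a) w′) ⟩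
          ⟦ reverse a ++ t ∷ (a ++ w′) ⟧  ≈⟨ ≃-++ˡ (reverse a) {t ∷ (a ++ w′)} {u} (≈-sym (≃-flip {t} {u} {a ++ w′} (≈-sym y≃))) ⟩
          ⟦ reverse a ++ (a ++ w) ⟧       ≈⟨ ⟦⟧-++ (reverse a) (a ++ w) ⟩
          ⟦ reverse a ⟧ ∙ ⟦ a ++ w ⟧      ≈⟨ ∙-congˡ (⟦⟧-++ a w) ⟩
          ⟦ reverse a ⟧ ∙ (⟦ a ⟧ ∙ ⟦ w ⟧) ≈⟨ ≈-sym (assoc _ _ _) ⟩
          (⟦ reverse a ⟧ ∙ ⟦ a ⟧) ∙ ⟦ w ⟧ ≈⟨ ≈-trans (∙-congʳ (⟦reverse⟧-inverse a)) (identityˡ _) ⟩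
          ⟦ w ⟧                           ∎

  module _ {r t : Fin n} (r≢t : r ≢ t) where

    descends-full : ∀ l w → suc l ≡ m r t → Descends t (alt r t (suc l) ++ w)
    descends-full l w e = alt r t l ++ w
      , ≃-++ʳ w {alt t r (suc l)} {alt r t (suc l)}
          (subst (λ k → alt t r k ≃ alt r t k) (≡.sym e) (≈-sym (alternating-relation r t λ e′ → 1+l≢0 (≡.trans e e′))))
      , cong suc (≡.trans (List.length-++ (alt r t l)) (≡.trans (cong (ℕ._+ length w) (≡.trans (length-alt r t l) (≡.sym (length-alt t r l)))) (≡.sym (List.length-++ (alt t r l)))))
      where
      1+l≢0 : suc l ≢ 0
      1+l≢0 ()

  -- The bound k drops on each round of the mutual recursion: `peel` asks only about what remains
  -- after an alternating prefix has been split off.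
  descends? : ∀ k u → length u ≤ k → Reduced u → ∀ i → Descends i u ⊎ Reduced (i ∷ u)

  -- Letters of {r,t} are pulled out of w one at a time. At length m(r,t) the braid relation
  -- exposes t; if w has no descent in {r,t} earlier, t is not a descent by ascends.
  peel : ∀ k {r t} → r ≢ t → ∀ l w → length w ≤ k → Reduced (alt r t (suc l) ++ w) →
    m r t ≡ 0 ⊎ suc l ≤ m r t →
    Descends t (alt r t (suc l) ++ w) ⊎ Reduced (t ∷ alt r t (suc l) ++ w)
  peel-next : ∀ k {r t} → r ≢ t → ∀ l w → length w ≤ k → Reduced (alt r t (suc l) ++ w) →
    m r t ≡ 0 ⊎ suc l < m r t →
    Descends (letter r t (suc l)) w ⊎ Reduced (letter r t (suc l) ∷ w) →
    Descends t (alt r t (suc l) ++ w) ⊎ Reduced (t ∷ alt r t (suc l) ++ w)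

  descends? k [] _ red i = inj₂ λ
    -- s_i ≠ e, because the reflection s_i has odd parity in the one-letter word and even parity in
    -- the empty one.
    { [] e → ⊥-elim (proj₁ (η-cong {[]} {i ∷ []} e (s i)) (λ ()) (inj₁ (≈-refl , λ ())))
    ; (_ ∷ _) _ → s≤s z≤n }
  descends? (suc k) (r ∷ u) (s≤s u≤k) red i with r ≟ i
  ... | yes refl = inj₁ (u , ≈-refl , refl)
  ... | no r≢i = peel k r≢i 0 u u≤k red (one≤ (offdiag r i r≢i))
    where
    one≤ : m r i ≡ 0 ⊎ 2 ≤ m r i → m r i ≡ 0 ⊎ 1 ≤ m r i
    one≤ (inj₁ e) = inj₁ e
    one≤ (inj₂ le) = inj₂ (ℕ.≤-trans (s≤s z≤n) le)

  peel k {r} {t} r≢t l w w≤k red small with suc l ℕ.≟ m r t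
  ... | yes e = inj₁ (descends-full r≢t l w e)
  ... | no ≢m = peel-next k r≢t l w w≤k red (strict small)
                  (descends? k w w≤k (Reduced-++⁻ʳ (alt r t (suc l)) {w} red) (letter r t (suc l)))
    where
    strict : m r t ≡ 0 ⊎ suc l ≤ m r t → m r t ≡ 0 ⊎ suc l < m r t
    strict (inj₁ e) = inj₁ e
    strict (inj₂ le) = inj₂ (ℕ.≤∧≢⇒< le ≢m)

  peel-next k r≢t l w w≤k red small (inj₂ red′) = inj₂ (ascends r≢t l {w} red red′ small)
  peel-next zero r≢t l (_ ∷ _) () red small (inj₁ _)
  peel-next (suc k) {r} {t} r≢t l w w≤k red small (inj₁ (v , v≃ , len)) =
    transfer (peel k r≢t (suc l) v v≤k (Reduced-resp {u} {u′} (≈-sym u′≃u) (≡.sym lengths) red) small)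
    where
    next = letter r t (suc l)
    u = alt r t (suc l) ++ w
    u′ = alt r t (suc (suc l)) ++ v
    v≤k : length v ≤ k
    v≤k = ℕ.≤-pred (ℕ.≤-trans (ℕ.≤-reflexive len) w≤k)
    u′≡ : u′ ≡ alt r t (suc l) ++ next ∷ v
    u′≡ = ≡.trans (cong (_++ v) (alt-snoc r t (suc l))) (List.++-assoc (alt r t (suc l)) (next ∷ []) v)
    u′≃u : u′ ≃ u
    u′≃u = ≈-trans (≡⇒≃ u′≡) (≃-++ˡ (alt r t (suc l)) {next ∷ v} {w} v≃)
    lengths : length u′ ≡ length u
    lengths = ≡.trans (cong length u′≡) (≡.trans (List.length-++ (alt r t (suc l)))
      (≡.trans (cong (length (alt r t (suc l)) ℕ.+_) len) (≡.sym (List.length-++ (alt r t (suc l))))))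
    transfer : Descends t u′ ⊎ Reduced (t ∷ u′) → Descends t u ⊎ Reduced (t ∷ u)
    transfer (inj₁ (x , e , l)) = inj₁ (x , ≈-trans e u′≃u , ≡.trans l lengths)
    transfer (inj₂ red″) = inj₂ (Reduced-resp {t ∷ u′} {t ∷ u} (∙-congˡ u′≃u) (cong suc lengths) red″)

  reduce : ∀ u → ∃[ v ] (v ≃ u × Reduced v)
  reduce [] = [] , ≈-refl , (λ _ _ → z≤n)
  reduce (i ∷ u) with reduce u
  ... | v , v≃u , red with descends? (length v) v ℕ.≤-refl red i
  ...   | inj₂ red′ = i ∷ v , ∙-congˡ v≃u , red′
  ...   | inj₁ (x , e , len) = x , ≈-trans x≃ (∙-congˡ v≃u) , x-red
    where
    x≃ : x ≃ i ∷ v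
    x≃ = ≃-flip {i} {x} {v} e
    x-red : Reduced x
    x-red y y≃x = ℕ.≤-pred (subst (_≤ suc (length y)) (≡.sym len) (red (i ∷ y) (≈-trans (∙-congˡ y≃x) e)))

-- Length and Bruhat order

module Length {c ℓ : Level} (W : Group c ℓ) {n : ℕ} (m : Fin n → Fin n → ℕ)
  (s : Fin n → Group.Carrier W) (cox : IsCoxeterSystem W m s) where

  open Descents W m s cox public
  open Group W renaming (refl to ≈-refl; sym to ≈-sym; trans to ≈-trans; reflexive to ≈-reflexive)
  open IsCoxeterSystem cox
  open SetoidReasoning setoid
  open GroupProperties W

  reduced-word : ∀ x → ∃[ u ] (⟦ u ⟧ ≈ x × Reduced u)
  reduced-word x with generates x
  ... | v , v≈x with reduce v
  ...   | u , u≃v , red = u , ≈-trans u≃v v≈x , red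

  word : Carrier → Word
  word x = proj₁ (reduced-word x)

  word-≈ : ∀ x → ⟦ word x ⟧ ≈ x
  word-≈ x = proj₁ (proj₂ (reduced-word x))

  len : Carrier → ℕ
  len x = length (word x)

  len-least : ∀ {x} u → ⟦ u ⟧ ≈ x → len x ≤ length u
  len-least {x} u e = proj₂ (proj₂ (reduced-word x)) u (≈-trans e (≈-sym (word-≈ x)))

  len-cong : ∀ {x y} → x ≈ y → len x ≡ len y
  len-cong {x} {y} e = ℕ.≤-antisym
    (len-least (word y) (≈-trans (word-≈ y) (≈-sym e)))
    (len-least (word x) (≈-trans (word-≈ x) e))

  len-0 : ∀ x → len x ≡ 0 → x ≈ ε
  len-0 x e with word x | word-≈ x
  ... | [] | e′ = ≈-sym e′
  len-0 x () | _ ∷ _ | _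

  infix 4 _≈?_
  _≈?_ : ∀ x y → Dec (x ≈ y)
  x ≈? y with len (x ∙ y ⁻¹) ℕ.≟ 0
  ... | yes e = yes (begin
    x              ≈⟨ identityʳ x ⟨
    x ∙ ε          ≈⟨ ∙-congˡ (inverseˡ y) ⟨
    x ∙ (y ⁻¹ ∙ y) ≈⟨ assoc _ _ _ ⟨
    (x ∙ y ⁻¹) ∙ y ≈⟨ ∙-congʳ (len-0 _ e) ⟩
    ε ∙ y          ≈⟨ identityˡ y ⟩
    y              ∎)
  ... | no ≢0 = no λ e → ≢0 (ℕ.n≤0⇒n≡0 (len-least [] (≈-trans (≈-sym (inverseʳ y)) (∙-congʳ (≈-sym e)))))

  s⁻¹ : ∀ i → s i ⁻¹ ≈ s i
  s⁻¹ i = ≈-sym (inverseˡ-unique _ _ (s² i))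

  len-⁻¹-≤ : ∀ x → len (x ⁻¹) ≤ len x
  len-⁻¹-≤ x = ℕ.≤-trans
    (len-least (reverse (word x)) (≈-trans (⟦reverse⟧ (word x)) (⁻¹-cong (word-≈ x))))
    (ℕ.≤-reflexive (List.length-reverse (word x)))

  len-⁻¹ : ∀ x → len (x ⁻¹) ≡ len x
  len-⁻¹ x = ℕ.≤-antisym (len-⁻¹-≤ x)
    (ℕ.≤-trans (ℕ.≤-reflexive (len-cong (≈-sym (⁻¹-involutive x)))) (len-⁻¹-≤ (x ⁻¹)))

  data Dichotomy (a b : ℕ) : Set where
    down : suc a ≡ b → Dichotomy a b
    up : a ≡ suc b → Dichotomy a b

  left-dichotomy : ∀ i x → Dichotomy (len (s i ∙ x)) (len x)
  left-dichotomy i x with descends? (len x) (word x) ℕ.≤-refl (proj₂ (proj₂ (reduced-word x))) i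
  ... | inj₁ (v , e , l) = down (ℕ.≤-antisym
    (ℕ.≤-trans (s≤s (len-least v v≈)) (ℕ.≤-reflexive l))
    (len-least (i ∷ word (s i ∙ x)) (≈-trans (∙-congˡ (word-≈ (s i ∙ x))) (s-cancelˡ i x))))
    where
    v≈ : ⟦ v ⟧ ≈ s i ∙ x
    v≈ = ≈-trans (≃-flip {i} {v} {word x} e) (∙-congˡ (word-≈ x))
  ... | inj₂ red = up (ℕ.≤-antisym
    (len-least (i ∷ word x) (∙-congˡ (word-≈ x)))
    (red (word (s i ∙ x)) (≈-trans (word-≈ _) (∙-congˡ (≈-sym (word-≈ x))))))

  s⁻¹-left : ∀ i x → (s i ∙ x) ⁻¹ ≈ x ⁻¹ ∙ s i
  s⁻¹-left i x = ≈-trans (⁻¹-anti-homo-∙ _ _) (∙-congˡ (s⁻¹ i))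

  s⁻¹-right : ∀ x i → (x ∙ s i) ⁻¹ ≈ s i ∙ x ⁻¹
  s⁻¹-right x i = ≈-trans (⁻¹-anti-homo-∙ _ _) (∙-congʳ (s⁻¹ i))

  len-right : ∀ x i → len (x ∙ s i) ≡ len (s i ∙ x ⁻¹)
  len-right x i = ≡.trans (≡.sym (len-⁻¹ _)) (len-cong (s⁻¹-right x i))

  len-left : ∀ i x → len (s i ∙ x) ≡ len (x ⁻¹ ∙ s i)
  len-left i x = ≡.trans (≡.sym (len-⁻¹ _)) (len-cong (s⁻¹-left i x))

  right-dichotomy : ∀ x i → Dichotomy (len (x ∙ s i)) (len x)
  right-dichotomy x i rewrite len-right x i | ≡.sym (len-⁻¹ x) = left-dichotomy i (x ⁻¹)

  reflection-≈ : ∀ x i → reflection x i ≈ (⟦ x ⟧ ∙ s i) ∙ ⟦ x ⟧ ⁻¹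
  reflection-≈ [] i = ≈-sym (≈-trans (∙-cong (identityˡ _) ε⁻¹≈ε) (identityʳ _))
  reflection-≈ (a ∷ x) i = begin
    s a ∙ (reflection x i ∙ s a)                    ≈⟨ ∙-congˡ (∙-congʳ (reflection-≈ x i)) ⟩
    s a ∙ (((⟦ x ⟧ ∙ s i) ∙ ⟦ x ⟧ ⁻¹) ∙ s a)        ≈⟨ ∙-congˡ (assoc _ _ _) ⟩
    s a ∙ ((⟦ x ⟧ ∙ s i) ∙ (⟦ x ⟧ ⁻¹ ∙ s a))        ≈⟨ assoc _ _ _ ⟨
    (s a ∙ (⟦ x ⟧ ∙ s i)) ∙ (⟦ x ⟧ ⁻¹ ∙ s a)        ≈⟨ ∙-cong (assoc _ _ _) (s⁻¹-left a ⟦ x ⟧) ⟨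
    ((s a ∙ ⟦ x ⟧) ∙ s i) ∙ (s a ∙ ⟦ x ⟧) ⁻¹        ∎

  conj-by : ∀ u t → (u ∙ (t ∙ u ⁻¹)) ∙ u ≈ u ∙ t
  conj-by u t = begin
    (u ∙ (t ∙ u ⁻¹)) ∙ u ≈⟨ assoc _ _ _ ⟩
    u ∙ ((t ∙ u ⁻¹) ∙ u) ≈⟨ ∙-congˡ (assoc _ _ _) ⟩
    u ∙ (t ∙ (u ⁻¹ ∙ u)) ≈⟨ ∙-congˡ (∙-congˡ (inverseˡ u)) ⟩
    u ∙ (t ∙ ε)          ≈⟨ ∙-congˡ (identityʳ t) ⟩
    u ∙ t                ∎

  conj-conj-by : ∀ u x t → u ∙ (((x ∙ t) ∙ x ⁻¹) ∙ u ⁻¹) ≈ ((u ∙ x) ∙ t) ∙ (u ∙ x) ⁻¹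
  conj-conj-by u x t = begin
    u ∙ (((x ∙ t) ∙ x ⁻¹) ∙ u ⁻¹) ≈⟨ ∙-congˡ (assoc _ _ _) ⟩
    u ∙ ((x ∙ t) ∙ (x ⁻¹ ∙ u ⁻¹)) ≈⟨ assoc _ _ _ ⟨
    (u ∙ (x ∙ t)) ∙ (x ⁻¹ ∙ u ⁻¹) ≈⟨ ∙-cong (assoc _ _ _) (⁻¹-anti-homo-∙ u x) ⟨
    ((u ∙ x) ∙ t) ∙ (u ∙ x) ⁻¹    ∎

  -- Exchange multiplies on the left, so t is first moved to utu⁻¹ = (ux)s_k(ux)⁻¹. If uts_i were no
  -- longer than us_i, a letter of the reduced word u i could be deleted to give uts_i. Deleting the
  -- final i means t = s_i; deleting inside u makes ut shorter than u.
  reflection-step : ∀ u x k i → let t = (x ∙ s k) ∙ x ⁻¹ in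
    len u < len (u ∙ t) → ¬ t ≈ s i → len u < len (u ∙ s i) → len (u ∙ s i) < len ((u ∙ t) ∙ s i)
  reflection-step u x k i u<ut t≉s u<us =
    decidable-stable (len (u ∙ s i) ℕ.<? len ((u ∙ t) ∙ s i)) λ ≮ →
      strong-exchange {a ++ i ∷ []} {v} (word (u ∙ x)) k red v≈ (v≤ (ℕ.≮⇒≥ ≮))
        λ { (w , d , w≈) → absurd (≈-trans w≈ (≈-trans (≈-sym v≈) (word-≈ _))) (Del-++ a d) }
    where
    t = (x ∙ s k) ∙ x ⁻¹
    a = word u
    v = word ((u ∙ t) ∙ s i)
    a≈ : ⟦ a ++ i ∷ [] ⟧ ≈ u ∙ s i
    a≈ = ≈-trans (⟦⟧-++ a (i ∷ [])) (∙-cong (word-≈ u) (identityʳ _))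
    a-length : length (a ++ i ∷ []) ≡ suc (len u)
    a-length = ≡.trans (List.length-++ a) (ℕ.+-comm (len u) 1)
    red : Reduced (a ++ i ∷ [])
    red y y≃ = ℕ.≤-trans (ℕ.≤-reflexive a-length) (ℕ.≤-trans u<us (len-least y (≈-trans y≃ a≈)))
    v≤ : len ((u ∙ t) ∙ s i) ≤ len (u ∙ s i) → length v ≤ length (a ++ i ∷ [])
    v≤ le = ℕ.≤-trans le (len-least (a ++ i ∷ []) a≈)
    v≈ : ⟦ v ⟧ ≈ reflection (word (u ∙ x)) k ∙ ⟦ a ++ i ∷ [] ⟧
    v≈ = begin
      ⟦ v ⟧                                         ≈⟨ word-≈ _ ⟩
      (u ∙ t) ∙ s i                                 ≈⟨ ∙-congʳ (conj-by u t) ⟨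
      ((u ∙ (t ∙ u ⁻¹)) ∙ u) ∙ s i                  ≈⟨ assoc _ _ _ ⟩
      (u ∙ (t ∙ u ⁻¹)) ∙ (u ∙ s i)                  ≈⟨ ∙-cong (conj-conj-by u x (s k)) (≈-sym a≈) ⟩
      (((u ∙ x) ∙ s k) ∙ (u ∙ x) ⁻¹) ∙ ⟦ a ++ i ∷ [] ⟧
        ≈⟨ ∙-congʳ (∙-cong (∙-congʳ (word-≈ (u ∙ x))) (⁻¹-cong (word-≈ (u ∙ x)))) ⟨
      ((⟦ word (u ∙ x) ⟧ ∙ s k) ∙ ⟦ word (u ∙ x) ⟧ ⁻¹) ∙ ⟦ a ++ i ∷ [] ⟧
        ≈⟨ ∙-congʳ (reflection-≈ (word (u ∙ x)) k) ⟨
      reflection (word (u ∙ x)) k ∙ ⟦ a ++ i ∷ [] ⟧ ∎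
    absurd : ∀ {w} → ⟦ w ⟧ ≈ (u ∙ t) ∙ s i →
      (∃[ a′ ] (Del a a′ × w ≡ a′ ++ i ∷ [])) ⊎ (∃[ y ] (Del (i ∷ []) y × w ≡ a ++ y)) → ⊥
    absurd w≈ (inj₁ (a′ , d , refl)) = ℕ.<⇒≱ u<ut (ℕ.≤-trans
      (len-least a′ (∙-cancelʳ (s i) _ _ (≈-trans (≈-sym (≈-trans (⟦⟧-++ a′ (i ∷ [])) (∙-congˡ (identityʳ _)))) w≈)))
      (ℕ.≤-trans (ℕ.n≤1+n _) (ℕ.≤-reflexive (Del-length d))))
    absurd w≈ (inj₂ ([] , here , refl)) = t≉s (∙-cancelʳ (s i) _ _ (≈-trans
      (∙-cancelˡ u _ _ (≈-trans (≈-sym (assoc _ _ _)) (≈-trans (≈-sym w≈) (≈-trans (⟦⟧-++ a []) (∙-congʳ (word-≈ u))))))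
      (≈-sym (s² i))))

  -- s_j u = ut for the reflection t = u⁻¹ s_j u. Unless t = s_i, `reflection-step` makes s_j u s_i
  -- longer than u s_i.
  square-step : ∀ u j i → len u < len (s j ∙ u) → len u < len (u ∙ s i) →
    len ((s j ∙ u) ∙ s i) < len (u ∙ s i) → s j ∙ u ≈ u ∙ s i
  square-step u j i u<su u<us sus<us = decide (t ≈? s i)
    where
    t = (u ⁻¹ ∙ s j) ∙ u ⁻¹ ⁻¹
    ut≈ : u ∙ t ≈ s j ∙ u
    ut≈ = begin
      u ∙ ((u ⁻¹ ∙ s j) ∙ u ⁻¹ ⁻¹) ≈⟨ ∙-congˡ (∙-congˡ (⁻¹-involutive u)) ⟩
      u ∙ ((u ⁻¹ ∙ s j) ∙ u)       ≈⟨ ∙-congˡ (assoc _ _ _) ⟩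
      u ∙ (u ⁻¹ ∙ (s j ∙ u))       ≈⟨ assoc _ _ _ ⟨
      (u ∙ u ⁻¹) ∙ (s j ∙ u)       ≈⟨ ∙-congʳ (inverseʳ u) ⟩
      ε ∙ (s j ∙ u)                ≈⟨ identityˡ _ ⟩
      s j ∙ u                      ∎
    decide : Dec (t ≈ s i) → s j ∙ u ≈ u ∙ s i
    decide (yes e) = ≈-trans (≈-sym ut≈) (∙-congˡ e)
    decide (no t≉s) = ⊥-elim (ℕ.<-asym sus<us (subst (len (u ∙ s i) <_) (len-cong (∙-congʳ ut≈))
      (reflection-step u (u ⁻¹) j i (subst (len u <_) (len-cong (≈-sym ut≈)) u<su) t≉s u<us)))

-- Bruhat order and its lifting properties on both sides

module Bruhat {c ℓ : Level} (W : Group c ℓ) {n : ℕ} (m : Fin n → Fin n → ℕ)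
  (s : Fin n → Group.Carrier W) (cox : IsCoxeterSystem W m s)
  (θ : Group.Carrier W → Group.Carrier W) where

  open Length W m s cox public
  open Coxeter W s θ public renaming (_≤B_ to infix 4 _≤B_; _ℓ<_ to infix 4 _ℓ<_)
  open Group W renaming (refl to ≈-refl; sym to ≈-sym; trans to ≈-trans; reflexive to ≈-reflexive)
  open SetoidReasoning setoid
  open GroupProperties W

  Len-len : ∀ x → Len x (len x)
  Len-len x = (word x , refl , word-≈ x) , len-least

  Len-unique : ∀ {x k} → Len x k → k ≡ len x
  Len-unique {x} ((u , refl , e) , least) = ℕ.≤-antisym (least (word x) (word-≈ x)) (len-least u e)

  ℓ<⇒< : ∀ {x y} → x ℓ< y → len x < len y
  ℓ<⇒< (a , b , la , lb , a<b) rewrite Len-unique la | Len-unique lb = a<b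

  <⇒ℓ< : ∀ {x y} → len x < len y → x ℓ< y
  <⇒ℓ< lt = _ , _ , Len-len _ , Len-len _ , lt

  ≤B-respˡ : ∀ {u u′ v} → u ≈ u′ → u ≤B v → u′ ≤B v
  ≤B-respˡ e (≤B-refl e′) = ≤B-refl (≈-trans (≈-sym e) e′)
  ≤B-respˡ {u} {u′} e (≤B-step t rt lt le) = ≤B-step t rt
    (<⇒ℓ< (≡.subst₂ _<_ (len-cong e) (len-cong (∙-congʳ e)) (ℓ<⇒< lt)))
    (≤B-respˡ (∙-congʳ e) le)

  ≤B-trans : ∀ {u v w} → u ≤B v → v ≤B w → u ≤B w
  ≤B-trans (≤B-refl e) le = ≤B-respˡ (≈-sym e) le
  ≤B-trans (≤B-step t rt lt le) le′ = ≤B-step t rt lt (≤B-trans le le′)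

  ≤B-respʳ : ∀ {u v v′} → v ≈ v′ → u ≤B v → u ≤B v′
  ≤B-respʳ e le = ≤B-trans le (≤B-refl e)

  ≤B⇒≤ : ∀ {u v} → u ≤B v → len u ≤ len v
  ≤B⇒≤ (≤B-refl e) = ℕ.≤-reflexive (len-cong e)
  ≤B⇒≤ (≤B-step t rt lt le) = ℕ.≤-trans (ℕ.<⇒≤ (ℓ<⇒< lt)) (≤B⇒≤ le)

  ≤B-antisym : ∀ {u v} → u ≤B v → len v ≤ len u → u ≈ v
  ≤B-antisym (≤B-refl e) _ = e
  ≤B-antisym (≤B-step t rt lt le) v≤u = ⊥-elim (ℕ.<⇒≱ (ℓ<⇒< lt) (ℕ.≤-trans (≤B⇒≤ le) v≤u))

  ≤B∧≉⇒< : ∀ {u v} → u ≤B v → ¬ u ≈ v → len u < len v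
  ≤B∧≉⇒< le u≉v = ℕ.≰⇒> λ v≤u → u≉v (≤B-antisym le v≤u)

  reflection-≤B : ∀ {u t v} → IsReflection t → u ∙ t ≈ v → len u < len v → u ≤B v
  reflection-≤B rt e lt = ≤B-step _ rt (<⇒ℓ< (subst (len _ <_) (len-cong (≈-sym e)) lt)) (≤B-refl e)

  s-isReflection : ∀ i → IsReflection (s i)
  s-isReflection i = ε , i , ≈-sym (≈-trans (∙-cong (identityˡ _) ε⁻¹≈ε) (identityʳ _))

  ascent-≤B : ∀ {x i} → len x < len (x ∙ s i) → x ≤B x ∙ s i
  ascent-≤B {x} {i} = reflection-≤B (s-isReflection i) ≈-refl

  descent-≤B : ∀ {x i} → len (x ∙ s i) < len x → x ∙ s i ≤B x
  descent-≤B {x} {i} = reflection-≤B (s-isReflection i) (s-cancelʳ i x)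

  IsReflection-conj : ∀ {t} u → IsReflection t → IsReflection (u ∙ (t ∙ u ⁻¹))
  IsReflection-conj u (x , k , e) = u ∙ x , k , ≈-trans (∙-congˡ (∙-congʳ e)) (conj-conj-by u x (s k))

  IsReflection-⁻¹ : ∀ {t} → IsReflection t → t ⁻¹ ≈ t
  IsReflection-⁻¹ {t} (x , k , e) = begin
    t ⁻¹                         ≈⟨ ⁻¹-cong e ⟩
    ((x ∙ s k) ∙ x ⁻¹) ⁻¹        ≈⟨ ⁻¹-anti-homo-∙ _ _ ⟩
    x ⁻¹ ⁻¹ ∙ (x ∙ s k) ⁻¹       ≈⟨ ∙-cong (⁻¹-involutive x) (s⁻¹-right x k) ⟩
    x ∙ (s k ∙ x ⁻¹)             ≈⟨ assoc _ _ _ ⟨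
    (x ∙ s k) ∙ x ⁻¹             ≈⟨ e ⟨
    t                            ∎

  conj-≤B : ∀ {u t} i → IsReflection t → len (u ∙ s i) < len ((u ∙ t) ∙ s i) → u ∙ s i ≤B (u ∙ t) ∙ s i
  conj-≤B {u} {t} i rt = reflection-≤B (IsReflection-conj (s i) rt) (begin
    (u ∙ s i) ∙ (s i ∙ (t ∙ s i ⁻¹)) ≈⟨ assoc _ _ _ ⟨
    ((u ∙ s i) ∙ s i) ∙ (t ∙ s i ⁻¹) ≈⟨ ∙-cong (s-cancelʳ i u) (∙-congˡ (s⁻¹ i)) ⟩
    u ∙ (t ∙ s i)                    ≈⟨ assoc _ _ _ ⟨
    (u ∙ t) ∙ s i                    ∎)

  reflection-step-≤B : ∀ {u t} i → IsReflection t → len u < len (u ∙ t) → ¬ t ≈ s i →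
    len u < len (u ∙ s i) → u ∙ s i ≤B (u ∙ t) ∙ s i
  reflection-step-≤B {u} {t} i rt@(x , k , e) u<ut t≉s u<us = conj-≤B i rt
    (subst (len (u ∙ s i) <_) (len-cong (∙-congʳ (∙-congˡ (≈-sym e))))
      (reflection-step u x k i (subst (len u <_) (len-cong (∙-congˡ e)) u<ut) (λ e′ → t≉s (≈-trans e e′)) u<us))

  data Direction (x : Carrier) (i : Fin n) : Set where
    descent : len (x ∙ s i) < len x → Direction x i
    ascent : len x < len (x ∙ s i) → Direction x i

  direction : ∀ x i → Direction x i
  direction x i with right-dichotomy x i
  ... | down e = descent (ℕ.≤-reflexive e)
  ... | up e = ascent (ℕ.≤-reflexive (≡.sym e))

  -- Induction on the chain from u to w. When s_i is an ascent of u, either the first step of the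
  -- chain is already s_i, or that step can be moved to one from us_i to uts_i.
  lift-up : ∀ {u w i} → u ≤B w → len (w ∙ s i) < len w → u ∙ s i ≤B w
  lift-up {w = w} {i} (≤B-refl e) ws<w = ≤B-respˡ (∙-congʳ (≈-sym e)) (descent-≤B ws<w)
  lift-up {u} {w} {i} (≤B-step t rt lt le) ws<w with direction u i | t ≈? s i
  ... | descent us<u | _ = ≤B-trans (descent-≤B us<u) (≤B-step t rt lt le)
  ... | ascent u<us | yes e = ≤B-respˡ (∙-congˡ e) le
  ... | ascent u<us | no t≉s = ≤B-trans (reflection-step-≤B i rt (ℓ<⇒< lt) t≉s u<us) (lift-up le ws<w)

  -- Both halves of the lifting property go through one induction on the chain, because its next
  -- element ut may have s_i as a descent or as an ascent regardless of u.
  lift-down-descent : ∀ {u v i} → u ≤B v → len (v ∙ s i) < len v → len (u ∙ s i) < len u → u ∙ s i ≤B v ∙ s i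
  lift-down-ascent : ∀ {u v i} → u ≤B v → len (v ∙ s i) < len v → len u < len (u ∙ s i) → u ≤B v ∙ s i

  lift-down-descent (≤B-refl e) vs<v us<u = ≤B-refl (∙-congʳ e)
  lift-down-descent {u} {v} {i} (≤B-step t rt lt le) vs<v us<u with right-dichotomy (u ∙ t) i
  ... | down e = ≤B-trans (conj-≤B i rt (ℕ.<-≤-trans us<u (ℕ.≤-pred (ℕ.≤-trans (ℓ<⇒< lt) (ℕ.≤-reflexive (≡.sym e))))))
                   (lift-down-descent le vs<v (ℕ.≤-reflexive e))
  ... | up e = ≤B-trans (descent-≤B us<u)
                 (≤B-trans (reflection-≤B rt ≈-refl (ℓ<⇒< lt)) (lift-down-ascent le vs<v (ℕ.≤-reflexive (≡.sym e))))

  lift-down-ascent {u} {v} {i} (≤B-refl e) vs<v u<us =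
    ⊥-elim (ℕ.<-asym vs<v (≡.subst₂ _<_ (len-cong e) (len-cong (∙-congʳ e)) u<us))
  lift-down-ascent {u} {v} {i} (≤B-step t rt lt le) vs<v u<us with direction (u ∙ t) i | t ≈? s i
  ... | ascent ut<uts | _ = ≤B-trans (reflection-≤B rt ≈-refl (ℓ<⇒< lt)) (lift-down-ascent le vs<v ut<uts)
  ... | descent uts<ut | yes e = ≤B-respˡ (≈-trans (∙-congʳ (∙-congˡ e)) (s-cancelʳ i u)) (lift-down-descent le vs<v uts<ut)
  ... | descent uts<ut | no t≉s = ≤B-trans (ascent-≤B u<us)
          (≤B-trans (reflection-step-≤B i rt (ℓ<⇒< lt) t≉s u<us) (lift-down-descent le vs<v uts<ut))

  -- The order is defined by right multiplication. Inversion carries the right-hand lifting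
  -- properties over to left multiplication.
  ≤B-⁻¹ : ∀ {u v} → u ≤B v → u ⁻¹ ≤B v ⁻¹
  ≤B-⁻¹ (≤B-refl e) = ≤B-refl (⁻¹-cong e)
  ≤B-⁻¹ {u} {v} (≤B-step t rt lt le) = ≤B-trans
    (reflection-≤B (IsReflection-conj u rt) (begin
      u ⁻¹ ∙ (u ∙ (t ∙ u ⁻¹)) ≈⟨ assoc _ _ _ ⟨
      (u ⁻¹ ∙ u) ∙ (t ∙ u ⁻¹) ≈⟨ ≈-trans (∙-congʳ (inverseˡ u)) (identityˡ _) ⟩
      t ∙ u ⁻¹                ≈⟨ ∙-congʳ (IsReflection-⁻¹ rt) ⟨
      t ⁻¹ ∙ u ⁻¹             ≈⟨ ⁻¹-anti-homo-∙ u t ⟨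
      (u ∙ t) ⁻¹              ∎)
      (≡.subst₂ _<_ (≡.sym (len-⁻¹ u)) (≡.sym (len-⁻¹ (u ∙ t))) (ℓ<⇒< lt)))
    (≤B-⁻¹ le)

  ≤B-⁻¹⁻ : ∀ {u v} → u ⁻¹ ≤B v ⁻¹ → u ≤B v
  ≤B-⁻¹⁻ {u} {v} le = ≤B-respˡ (⁻¹-involutive u) (≤B-respʳ (⁻¹-involutive v) (≤B-⁻¹ le))

  left-< : ∀ {x y i} → len (s i ∙ x) < len y → len (x ⁻¹ ∙ s i) < len (y ⁻¹)
  left-< {x} {y} {i} lt rewrite ≡.sym (len-left i x) | len-⁻¹ y = lt

  left-> : ∀ {x y i} → len x < len (s i ∙ y) → len (x ⁻¹) < len (y ⁻¹ ∙ s i)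
  left-> {x} {y} {i} lt rewrite ≡.sym (len-left i y) | len-⁻¹ x = lt

  left-lift-up : ∀ {u w i} → u ≤B w → len (s i ∙ w) < len w → s i ∙ u ≤B w
  left-lift-up {u} {w} {i} le lt = ≤B-⁻¹⁻ (≤B-respˡ (≈-sym (s⁻¹-left i u)) (lift-up (≤B-⁻¹ le) (left-< lt)))

  left-lift-down-descent : ∀ {u v i} → u ≤B v → len (s i ∙ v) < len v → len (s i ∙ u) < len u → s i ∙ u ≤B s i ∙ v
  left-lift-down-descent {u} {v} {i} le lt lt′ = ≤B-⁻¹⁻ (≤B-respˡ (≈-sym (s⁻¹-left i u))
    (≤B-respʳ (≈-sym (s⁻¹-left i v)) (lift-down-descent (≤B-⁻¹ le) (left-< lt) (left-< lt′))))

  left-lift-down-ascent : ∀ {u v i} → u ≤B v → len (s i ∙ v) < len v → len u < len (s i ∙ u) → u ≤B s i ∙ v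
  left-lift-down-ascent {u} {v} {i} le lt lt′ = ≤B-⁻¹⁻
    (≤B-respʳ (≈-sym (s⁻¹-left i v)) (lift-down-ascent (≤B-⁻¹ le) (left-< lt) (left-> lt′)))

  left-ascent-≤B : ∀ {x i} → len x < len (s i ∙ x) → x ≤B s i ∙ x
  left-ascent-≤B {x} {i} lt = ≤B-⁻¹⁻ (≤B-respʳ (≈-sym (s⁻¹-left i x)) (ascent-≤B (left-> lt)))

  left-descent-≤B : ∀ {x i} → len (s i ∙ x) < len x → s i ∙ x ≤B x
  left-descent-≤B {x} {i} lt = ≤B-⁻¹⁻ (≤B-respˡ (≈-sym (s⁻¹-left i x)) (descent-≤B (left-< lt)))

  ε-minimum : ∀ x → ε ≤B x
  ε-minimum x = ≤B-respʳ (word-≈ x) (go (word x) (proj₂ (proj₂ (reduced-word x))))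
    where
    go : ∀ u → Reduced u → ε ≤B ⟦ u ⟧
    go [] red = ≤B-refl ≈-refl
    go (i ∷ u) red = ≤B-trans (go u (Reduced-++⁻ʳ (i ∷ []) {u} red)) (left-ascent-≤B
      (ℕ.≤-trans (s≤s (len-least u ≈-refl)) (red (word (s i ∙ ⟦ u ⟧)) (word-≈ _))))

-- Twisted involutions

module TwistedInvolutions {c ℓ : Level} (W : Group c ℓ) {n : ℕ} (m : Fin n → Fin n → ℕ)
  (s : Fin n → Group.Carrier W) (cox : IsCoxeterSystem W m s)
  (θ : Group.Carrier W → Group.Carrier W) (aut : Coxeter.IsInvolutiveDiagramAut W s θ) (i : Fin n) where

  open Bruhat W m s cox θ
  open Group W renaming (refl to ≈-refl; sym to ≈-sym; trans to ≈-trans; reflexive to ≈-reflexive)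
  open SetoidReasoning setoid
  open GroupProperties W
  open IsInvolutiveDiagramAut aut
  open GroupMorphisms.IsGroupIsomorphism automorphism using (isGroupHomomorphism)
  open GroupMorphisms.IsGroupHomomorphism isGroupHomomorphism using (homo; ε-homo; ⟦⟧-cong)

  θ-word : Word → Word
  θ-word = map (λ k → proj₁ (θS⊆S k))

  ⟦θ-word⟧ : ∀ u → ⟦ θ-word u ⟧ ≈ θ ⟦ u ⟧
  ⟦θ-word⟧ [] = ≈-sym ε-homo
  ⟦θ-word⟧ (k ∷ u) = ≈-trans (∙-cong (≈-sym (proj₂ (θS⊆S k))) (⟦θ-word⟧ u)) (≈-sym (homo (s k) ⟦ u ⟧))

  len-θ-≤ : ∀ x → len (θ x) ≤ len x
  len-θ-≤ x = ℕ.≤-trans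
    (len-least (θ-word (word x)) (≈-trans (⟦θ-word⟧ (word x)) (⟦⟧-cong (word-≈ x))))
    (ℕ.≤-reflexive (List.length-map _ (word x)))

  len-θ : ∀ x → len (θ x) ≡ len x
  len-θ x = ℕ.≤-antisym (len-θ-≤ x)
    (ℕ.≤-trans (ℕ.≤-reflexive (len-cong (≈-sym (involutive x)))) (len-θ-≤ (θ x)))

  j : Fin n
  j = proj₁ (θS⊆S i)

  θsᵢ : θ (s i) ≈ s j
  θsᵢ = proj₂ (θS⊆S i)

  θsⱼ : θ (s j) ≈ s i
  θsⱼ = ≈-trans (⟦⟧-cong (≈-sym θsᵢ)) (involutive (s i))

  infix 4 _⇝_
  -- x ⇝ y says that y = x s̲.
  data _⇝_ (x y : Carrier) : Set ℓ where
    fixed : s j ∙ x ≈ x ∙ s i → y ≈ x ∙ s i → x ⇝ y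
    moved : ¬ s j ∙ x ≈ x ∙ s i → y ≈ s j ∙ (x ∙ s i) → x ⇝ y

  sⱼxsᵢ≈x : ∀ {x} → s j ∙ x ≈ x ∙ s i → (s j ∙ x) ∙ s i ≈ x
  sⱼxsᵢ≈x {x} e = ≈-trans (∙-congʳ e) (s-cancelʳ i x)

  commutes : ∀ {x} → (s j ∙ x) ∙ s i ≈ x → s j ∙ x ≈ x ∙ s i
  commutes {x} e = ≈-trans (≈-sym (s-cancelʳ i _)) (∙-congʳ e)

  TwistedAct⇒⇝ : ∀ {x y} → TwistedAct x i y → x ⇝ y
  TwistedAct⇒⇝ (inj₁ (e , y≈)) = fixed (commutes (≈-trans (∙-congʳ (∙-congʳ (≈-sym θsᵢ))) e)) y≈
  TwistedAct⇒⇝ (inj₂ (ne , y≈)) = moved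
    (λ e → ne (≈-trans (∙-congʳ (∙-congʳ θsᵢ)) (sⱼxsᵢ≈x e)))
    (≈-trans y≈ (≈-trans (∙-congʳ (∙-congʳ θsᵢ)) (assoc _ _ _)))

  -- Combined with `⇝-sym`, this gives that `M` is an involution and that it separates distinct
  -- elements.
  ⇝-functional : ∀ {x x′ y y′} → x ≈ x′ → x ⇝ y → x′ ⇝ y′ → y ≈ y′
  ⇝-functional e (fixed _ y≈) (fixed _ y′≈) = ≈-trans y≈ (≈-trans (∙-congʳ e) (≈-sym y′≈))
  ⇝-functional e (moved _ y≈) (moved _ y′≈) = ≈-trans y≈ (≈-trans (∙-congˡ (∙-congʳ e)) (≈-sym y′≈))
  ⇝-functional e (fixed f _) (moved nf _) = ⊥-elim (nf (≈-trans (∙-congˡ (≈-sym e)) (≈-trans f (∙-congʳ e))))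
  ⇝-functional e (moved nf _) (fixed f _) = ⊥-elim (nf (≈-trans (∙-congˡ e) (≈-trans f (∙-congʳ (≈-sym e)))))

  moved-left : ∀ {x y} → y ≈ s j ∙ (x ∙ s i) → s j ∙ y ≈ x ∙ s i
  moved-left y≈ = ≈-trans (∙-congˡ y≈) (s-cancelˡ j _)

  moved-right : ∀ {x y} → y ≈ s j ∙ (x ∙ s i) → y ∙ s i ≈ s j ∙ x
  moved-right y≈ = ≈-trans (∙-congʳ y≈) (≈-trans (assoc _ _ _) (∙-congˡ (s-cancelʳ i _)))

  fixed-left : ∀ {x y} → s j ∙ x ≈ x ∙ s i → y ≈ x ∙ s i → s j ∙ y ≈ x
  fixed-left f y≈ = ≈-trans (∙-congˡ (≈-trans y≈ (≈-sym f))) (s-cancelˡ j _)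

  fixed-right : ∀ {x y} → y ≈ x ∙ s i → y ∙ s i ≈ x
  fixed-right y≈ = ≈-trans (∙-congʳ y≈) (s-cancelʳ i _)

  ⇝-sym : ∀ {x y} → x ⇝ y → y ⇝ x
  ⇝-sym (fixed f y≈) = fixed (≈-trans (fixed-left f y≈) (≈-sym (fixed-right y≈))) (≈-sym (fixed-right y≈))
  ⇝-sym (moved nf y≈) = moved
    (λ e → nf (≈-trans (≈-sym (moved-right y≈)) (≈-trans (≈-sym e) (moved-left y≈))))
    (≈-sym (≈-trans (∙-congˡ (moved-right y≈)) (s-cancelˡ j _)))

  Twisted-resp : ∀ {x y} → x ≈ y → TwistedInvolution x → TwistedInvolution y
  Twisted-resp e tw = ≈-trans (⟦⟧-cong (≈-sym e)) (≈-trans tw (⁻¹-cong e))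

  θ-xsᵢ : ∀ {x} → TwistedInvolution x → θ (x ∙ s i) ≈ (s j ∙ x) ⁻¹
  θ-xsᵢ {x} tw = ≈-trans (homo x (s i)) (≈-trans (∙-cong tw θsᵢ) (≈-sym (s⁻¹-left j x)))

  Twisted-⇝ : ∀ {x y} → TwistedInvolution x → x ⇝ y → TwistedInvolution y
  Twisted-⇝ {x} {y} tw (fixed f y≈) = Twisted-resp (≈-sym y≈) (≈-trans (θ-xsᵢ tw) (⁻¹-cong f))
  Twisted-⇝ {x} {y} tw (moved nf y≈) = Twisted-resp (≈-sym y≈) (begin
    θ (s j ∙ (x ∙ s i))       ≈⟨ homo (s j) _ ⟩
    θ (s j) ∙ θ (x ∙ s i)     ≈⟨ ∙-cong θsⱼ (θ-xsᵢ tw) ⟩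
    s i ∙ (s j ∙ x) ⁻¹        ≈⟨ s⁻¹-right _ i ⟨
    ((s j ∙ x) ∙ s i) ⁻¹      ≈⟨ ⁻¹-cong (assoc _ _ _) ⟩
    (s j ∙ (x ∙ s i)) ⁻¹      ∎)

  -- θ(xs_i) = (s_j x)⁻¹, which is (xs_i)⁻¹ exactly when s_j x = xs_i. This empties the rank between
  -- x and its partner in the moved case.
  Twisted-xsᵢ⇒fixed : ∀ {x} → TwistedInvolution x → TwistedInvolution (x ∙ s i) → s j ∙ x ≈ x ∙ s i
  Twisted-xsᵢ⇒fixed tw tw′ = ⁻¹-injective (≈-trans (≈-sym (θ-xsᵢ tw)) tw′)

  len-left-right : ∀ {x} → TwistedInvolution x → len (s j ∙ x) ≡ len (x ∙ s i)
  len-left-right {x} tw = ≡.trans (≡.sym (len-⁻¹ _)) (≡.trans (len-cong (≈-sym (θ-xsᵢ tw))) (len-θ _))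

  left-descent : ∀ {x} → TwistedInvolution x → len (x ∙ s i) < len x → len (s j ∙ x) < len x
  left-descent tw = subst (_< len _) (≡.sym (len-left-right tw))

  left-ascent : ∀ {x} → TwistedInvolution x → len x < len (x ∙ s i) → len x < len (s j ∙ x)
  left-ascent tw = subst (len _ <_) (≡.sym (len-left-right tw))

  -- If s_j raised xs_i, `square-step` at xs_i would give s_j xs_i = x, the fixed case. So in the
  -- moved case both multiplications go down, and the length drops by two.
  moved-descent : ∀ {x} → TwistedInvolution x → ¬ s j ∙ x ≈ x ∙ s i → len (x ∙ s i) < len x →
    len (s j ∙ (x ∙ s i)) < len (x ∙ s i)
  moved-descent {x} tw nf xs<x with left-dichotomy j (x ∙ s i)
  ... | down e = ℕ.≤-reflexive e
  ... | up e = ⊥-elim (nf (commutes (≈-trans (assoc _ _ _) (≈-trans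
      (square-step (x ∙ s i) j i (ℕ.≤-reflexive (≡.sym e))
        (subst (len (x ∙ s i) <_) (len-cong (≈-sym (s-cancelʳ i x))) xs<x)
        (≡.subst₂ _<_ (len-cong (≈-sym (moved-right ≈-refl))) (len-cong (≈-sym (s-cancelʳ i x))) (left-descent tw xs<x)))
      (s-cancelʳ i x)))))

  moved-ascent : ∀ {x} → TwistedInvolution x → ¬ s j ∙ x ≈ x ∙ s i → len x < len (x ∙ s i) →
    len (x ∙ s i) < len (s j ∙ (x ∙ s i))
  moved-ascent {x} tw nf x<xs with left-dichotomy j (x ∙ s i)
  ... | up e = ℕ.≤-reflexive (≡.sym e)
  ... | down e = ⊥-elim (nf (square-step x j i (left-ascent tw x<xs) x<xs
      (subst (_< len (x ∙ s i)) (len-cong (≈-sym (assoc _ _ _))) (ℕ.≤-reflexive e))))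

  ⇝-≤B-xsᵢ : ∀ {x y} → TwistedInvolution x → x ⇝ y → len (x ∙ s i) < len x → y ≤B x ∙ s i
  ⇝-≤B-xsᵢ tw (fixed f y≈) xs<x = ≤B-refl y≈
  ⇝-≤B-xsᵢ tw (moved nf y≈) xs<x = ≤B-respˡ (≈-sym y≈) (left-descent-≤B (moved-descent tw nf xs<x))

  ⇝-≤B : ∀ {x y} → TwistedInvolution x → x ⇝ y → len (x ∙ s i) < len x → y ≤B x
  ⇝-≤B tw xy xs<x = ≤B-trans (⇝-≤B-xsᵢ tw xy xs<x) (descent-≤B xs<x)

  ⇝-< : ∀ {x y} → TwistedInvolution x → x ⇝ y → len (x ∙ s i) < len x → len y < len x
  ⇝-< tw xy xs<x = ℕ.≤-<-trans (≤B⇒≤ (⇝-≤B-xsᵢ tw xy xs<x)) xs<x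

  ⇝-ascent : ∀ {x y} → TwistedInvolution x → x ⇝ y → len x < len (x ∙ s i) → len (y ∙ s i) < len y
  ⇝-ascent tw (fixed f y≈) x<xs = ≡.subst₂ _<_ (len-cong (≈-sym (fixed-right y≈))) (len-cong (≈-sym y≈)) x<xs
  ⇝-ascent {x} {y} tw (moved nf y≈) x<xs = ≡.subst₂ _<_
    (≡.trans (≡.sym (len-left-right tw)) (len-cong (≈-sym (moved-right y≈))))
    (len-cong (≈-sym y≈)) (moved-ascent tw nf x<xs)

  ⇝-lift-up : ∀ {w x y} → TwistedInvolution w → len (w ∙ s i) < len w → x ⇝ y → x ≤B w → y ≤B w
  ⇝-lift-up tw ws<w (fixed f y≈) x≤w = ≤B-respˡ (≈-sym y≈) (lift-up x≤w ws<w)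
  ⇝-lift-up tw ws<w (moved nf y≈) x≤w = ≤B-respˡ (≈-sym y≈)
    (left-lift-up (lift-up x≤w ws<w) (left-descent tw ws<w))

  -- Right lifting gives xs_i ≤ ys_i. If y is fixed, this already suffices, since x′ ≤ xs_i. If y is
  -- moved, left lifting by s_j follows: in its descent form when x is moved, and in its ascent form
  -- when x is fixed, as then s_j xs_i = x is longer than xs_i.
  ⇝-lift-down : ∀ {x x′ y y′} → TwistedInvolution x → TwistedInvolution y → x ⇝ x′ → y ⇝ y′ → x ≤B y →
    len (x ∙ s i) < len x → len (y ∙ s i) < len y → x′ ≤B y′
  ⇝-lift-down twx twy xx′ (fixed _ y′≈) x≤y xs<x ys<y = ≤B-respʳ (≈-sym y′≈)
    (≤B-trans (⇝-≤B-xsᵢ twx xx′ xs<x) (lift-down-descent x≤y ys<y xs<x))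
  ⇝-lift-down twx twy (moved nf x′≈) (moved nf′ y′≈) x≤y xs<x ys<y = ≤B-respˡ (≈-sym x′≈) (≤B-respʳ (≈-sym y′≈)
    (left-lift-down-descent (lift-down-descent x≤y ys<y xs<x) (moved-descent twy nf′ ys<y) (moved-descent twx nf xs<x)))
  ⇝-lift-down {x} twx twy (fixed f x′≈) (moved nf′ y′≈) x≤y xs<x ys<y = ≤B-respˡ (≈-sym x′≈) (≤B-respʳ (≈-sym y′≈)
    (left-lift-down-ascent (lift-down-descent x≤y ys<y xs<x) (moved-descent twy nf′ ys<y)
      (subst (len (x ∙ s i) <_) (len-cong (≈-sym (fixed-left f ≈-refl))) xs<x)))

  len-≤-right : ∀ x → len x ≤ suc (len (x ∙ s i))
  len-≤-right x with right-dichotomy x i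
  ... | down e = ℕ.≤-reflexive (≡.sym e)
  ... | up e = ℕ.≤-trans (ℕ.n≤1+n _) (ℕ.≤-trans (ℕ.≤-reflexive (≡.sym e)) (ℕ.n≤1+n _))

  len-≤-left : ∀ x → len x ≤ suc (len (s j ∙ x))
  len-≤-left x with left-dichotomy j x
  ... | down e = ℕ.≤-reflexive (≡.sym e)
  ... | up e = ℕ.≤-trans (ℕ.n≤1+n _) (ℕ.≤-trans (ℕ.≤-reflexive (≡.sym e)) (ℕ.n≤1+n _))

  nothing-between : ∀ {x y z} → TwistedInvolution x → TwistedInvolution z → x ⇝ y → len (x ∙ s i) < len x →
    y ≤B z → len y < len z → z ≤B x → len z < len x → ⊥
  nothing-between {x} {y} {z} twx twz (fixed f y≈) xs<x y≤z y<z z≤x z<x =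
    ℕ.<⇒≱ z<x (ℕ.≤-trans (len-≤-right x) (ℕ.≤-trans (s≤s (ℕ.≤-reflexive (len-cong (≈-sym y≈)))) y<z))
  nothing-between {x} {y} {z} twx twz xy@(moved nf y≈) xs<x y≤z y<z z≤x z<x with direction z i
  ... | ascent z<zs = nf (Twisted-xsᵢ⇒fixed twx (Twisted-resp z≈xs twz))
    where
    x≤2+y : len x ≤ suc (suc (len y))
    x≤2+y = ℕ.≤-trans (len-≤-right x) (s≤s (ℕ.≤-trans (len-≤-left (x ∙ s i)) (s≤s (ℕ.≤-reflexive (len-cong (≈-sym y≈))))))
    -- Lifting puts zs_i below x, and ℓ(zs_i) ≥ ℓ(z) + 1 ≥ ℓ(y) + 2 ≥ ℓ(x) leaves only equality.
    zs≈x : z ∙ s i ≈ x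
    zs≈x = ≤B-antisym (lift-up z≤x xs<x) (ℕ.≤-trans x≤2+y (ℕ.≤-trans (s≤s y<z) z<zs))
    z≈xs : z ≈ x ∙ s i
    z≈xs = ≈-trans (≈-sym (s-cancelʳ i z)) (∙-congʳ zs≈x)
  -- Here z is ys_i = s_j x, so the criterion is applied at y, and the resulting fixed case is
  -- transferred back to x.
  ... | descent zs<z = nf (begin
      s j ∙ x ≈⟨ moved-right y≈ ⟨
      y ∙ s i ≈⟨ Twisted-xsᵢ⇒fixed (Twisted-⇝ twx xy) (Twisted-resp (≈-sym ys≈z) twz) ⟨
      s j ∙ y ≈⟨ moved-left y≈ ⟩
      x ∙ s i ∎)
    where
    z≤ys : len z ≤ len (y ∙ s i)
    z≤ys = ℕ.≤-trans (ℕ.≤-pred (ℕ.≤-trans z<x (len-≤-right x)))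
      (ℕ.≤-reflexive (≡.trans (≡.sym (len-left-right twx)) (len-cong (≈-sym (moved-right y≈)))))
    ys≈z : y ∙ s i ≈ z
    ys≈z = ≤B-antisym (lift-up y≤z zs<z) z≤ys

  -- The special matching on the interval below w

  module _ (w : Carrier) (tww : TwistedInvolution w) (ws<w : len (w ∙ s i) < len w)
    (M : Carrier → Carrier) (x⇝Mx : ∀ x → x ⇝ M x) where

    private
      Q : Carrier → Set (c ⊔ ℓ)
      Q = InInterval w

    infix 4 _⊏_
    _⊏_ : Carrier → Carrier → Set (c ⊔ ℓ)
    x ⊏ y = _<Q_ Q x y

    M-maps-into : ∀ x → Q x → Q (M x)
    M-maps-into x (tw , _ , x≤w) = Twisted-⇝ tw (x⇝Mx x) , ε-minimum _ , ⇝-lift-up tww ws<w (x⇝Mx x) x≤w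

    <Q-intro : ∀ {x y} → x ≤B y → len x < len y → x ⊏ y
    <Q-intro x≤y x<y = x≤y , λ e → ℕ.<-irrefl (len-cong e) x<y

    <Q⇒< : ∀ {x y} → x ⊏ y → len x < len y
    <Q⇒< (x≤y , x≉y) = ≤B∧≉⇒< x≤y x≉y

    M-covers : ∀ {x y} → Q x → Q y → x ⇝ y → len (x ∙ s i) < len x → Covers Q x y
    M-covers qx@(twx , _) qy xy xs<x = qy , qx , <Q-intro (⇝-≤B twx xy xs<x) (⇝-< twx xy xs<x)
      , λ { z (twz , _) y<z z<x → nothing-between twx twz xy xs<x (proj₁ y<z) (<Q⇒< y<z) (proj₁ z<x) (<Q⇒< z<x) }

    M-matching : ∀ x → Q x → Covers Q x (M x) ⊎ Covers Q (M x) x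
    M-matching x qx with direction x i
    ... | descent xs<x = inj₁ (M-covers qx (M-maps-into x qx) (x⇝Mx x) xs<x)
    ... | ascent x<xs = inj₂ (M-covers (M-maps-into x qx) qx (⇝-sym (x⇝Mx x)) (⇝-ascent (proj₁ qx) (x⇝Mx x) x<xs))

    M-special : ∀ x y → Q x → Q y → ¬ (M x ≈ y) → Covers Q y x → M x ⊏ M y
    M-special x y qx@(twx , _) qy@(twy , _) Mx≉y (_ , _ , x<y@(x≤y , x≉y) , nothing) = cases (direction x i) (direction y i)
      where
      Mx≉My : ¬ M x ≈ M y
      Mx≉My e = x≉y (⇝-functional e (⇝-sym (x⇝Mx x)) (⇝-sym (x⇝Mx y)))
      Mx-ascent : len x < len (x ∙ s i) → x ⊏ M x
      Mx-ascent x<xs = <Q-intro (⇝-≤B twMx Mx⇝x Mxs<Mx) (⇝-< twMx Mx⇝x Mxs<Mx)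
        where
        Mx⇝x = ⇝-sym (x⇝Mx x)
        twMx = Twisted-⇝ twx (x⇝Mx x)
        Mxs<Mx = ⇝-ascent twx (x⇝Mx x) x<xs
      cases : Direction x i → Direction y i → M x ⊏ M y
      cases (descent xs<x) (descent ys<y) = ⇝-lift-down twx twy (x⇝Mx x) (x⇝Mx y) x≤y xs<x ys<y , Mx≉My
      cases (descent xs<x) (ascent y<ys) = ≤B-trans (⇝-≤B twx (x⇝Mx x) xs<x)
          (≤B-trans x≤y (⇝-≤B twMy (⇝-sym (x⇝Mx y)) (⇝-ascent twy (x⇝Mx y) y<ys))) , Mx≉My
        where
        twMy = Twisted-⇝ twy (x⇝Mx y)
      cases (ascent x<xs) (ascent y<ys) = ⇝-lift-up twMy Mys<My (x⇝Mx x)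
          (≤B-trans x≤y (⇝-≤B twMy (⇝-sym (x⇝Mx y)) Mys<My)) , Mx≉My
        where
        twMy = Twisted-⇝ twy (x⇝Mx y)
        Mys<My = ⇝-ascent twy (x⇝Mx y) y<ys
      -- M x lies above x by the ascent, below y by lifting, and differs from y by hypothesis, so it
      -- would sit strictly inside a covering pair.
      cases (ascent x<xs) (descent ys<y) = ⊥-elim (nothing (M x) (M-maps-into x qx) (Mx-ascent x<xs)
        (⇝-lift-up twy ys<y (x⇝Mx x) x≤y , Mx≉y))

    isSpecialMatching : IsSpecialMatching Q M
    isSpecialMatching = record
      { maps-into = M-maps-into
      ; involution = λ x _ → ⇝-functional ≈-refl (x⇝Mx (M x)) (⇝-sym (x⇝Mx x))
      ; matching = M-matching
      ; special = M-special }

theorem4p5 : {c ℓ : Level} (W : Group c ℓ) (n : ℕ) (m : Fin n → Fin n → ℕ)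
    (s : Fin n → Group.Carrier W) → IsCoxeterSystem W m s →
    (θ : Group.Carrier W → Group.Carrier W) → Coxeter.IsInvolutiveDiagramAut W s θ →
    (w : Group.Carrier W) → Coxeter.TwistedInvolution W s θ w →
    (i : Fin n) → Coxeter.RightDescent W s θ w i →
    (M : Group.Carrier W → Group.Carrier W) →
    (∀ v → Coxeter.TwistedAct W s θ v i (M v)) →
    Coxeter.IsSpecialMatching W s θ (Coxeter.InInterval W s θ w) M
theorem4p5 W n m s cox θ aut w tww i descends M acts =
  isSpecialMatching w tww (ℓ<⇒< descends) M (λ x → TwistedAct⇒⇝ (acts x))
  where
  open TwistedInvolutions W m s cox θ aut i
  open Bruhat W m s cox θ using (ℓ<⇒<)
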